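{- Let $t\ge 1$ be an integer, and for $n\ge 1$ let $h_t(n)$ denote the number of $t$-$\mathsf{Pop}$-sortable elements of the $n$-th Tamari lattice $\mathrm{Tam}_n$. Then, as formal power series, $$\sum_{n\ge 1} h_t(n)z^n=\frac{z}{1-2z-\sum_{j=2}^{t}C_{j-1}z^{j}},$$ where $C_m=\frac{1}{m+1}\binom{2m}{m}$ are the Catalan numbers (the sum in the denominator is empty when $t=1$).
   Context: For $n\ge1$, a Dyck path of semilength $n$ is a word in the letters $\mathrm{N}$ (unit step $(0,1)$) and $\mathrm{E}$ (unit step $(1,0)$) containing $n$ of each letter, such that every prefix contains at least as many $\mathrm{N}$'s as $\mathrm{E}$'s. The Tamari lattice $\mathrm{Tam}_n$ is the set of Dyck paths of semilength $n$, partially ordered by the reflexive-transitive closure of the covering relation $\mu\lessdot\mu'$ whenever $\mu=X\,\mathrm{E}\,D\,Y$ and $\mu'=X\,D\,\mathrm{E}\,Y$ for words $X,Y$ and $D=\mathrm{N}D'\mathrm{E}$ with $D'$ a (possibly empty) word having equally many $\mathrm{N}$'s and $\mathrm{E}$'s and every prefix having at least as many $\mathrm{N}$'s as $\mathrm{E}$'s. It is a finite lattice with minimum element $\hat 0=(\mathrm{NE})^n$. For a finite lattice $M$, define $\mathsf{Pop}_M:M\to M$ by $\mathsf{Pop}_M(x)=\bigwedge(\{y\in M: y\lessdot x\}\cup\{x\})$. An element $x$ is $t$-$\mathsf{Pop}$-sortable if $\mathsf{Pop}_M^t(x)=\hat0$, where $\mathsf{Pop}_M^t$ is the $t$-fold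 iterate. -}

module Defs where

open import Data.Nat using (ℕ; zero; suc; _≤_; _∸_; _≤?_) renaming (_+_ to _+ℕ_)
open import Data.Nat.Combinatorics using (_C_)
open import Data.Nat.DivMod using (_/_)
open import Data.Integer using (ℤ; +_; -_; _+_; _*_)
open import Data.List using (List; []; _∷_; _++_; length; concat; replicate; upTo; foldr; map)
open import Data.List.Membership.Propositional using (_∈_)
open import Data.List.Relation.Unary.Unique.Propositional using (Unique)
open import Data.Product using (Σ; _×_; _,_; ∃)
open import Data.Sum using (_⊎_)
open import Relation.Nullary using (¬_; yes; no)
open import Relation.Binary.PropositionalEquality using (_≡_)
open import Relation.Binary.Construct.Closure.ReflexiveTransitive using (Star)

data Step : Set where
  N E : Step

Word : Set
Word = List Step

countN : Word → ℕ
countN []      = 0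
countN (N ∷ w) = suc (countN w)
countN (E ∷ w) = countN w

countE : Word → ℕ
countE []      = 0
countE (N ∷ w) = countE w
countE (E ∷ w) = suc (countE w)

PrefixOK : Word → Set
PrefixOK w = ∀ (p q : Word) → p ++ q ≡ w → countE p ≤ countN p

Balanced : Word → Set
Balanced w = countN w ≡ countE w × PrefixOK w

Dyck : ℕ → Word → Set
Dyck n w = countN w ≡ n × countE w ≡ n × PrefixOK w

Rot : Word → Word → Set
Rot μ μ' = Σ Word λ X → Σ Word λ Y → Σ Word λ D' →
  Balanced D' ×
  μ  ≡ X ++ (E ∷ (N ∷ D' ++ (E ∷ []))) ++ Y ×
  μ' ≡ X ++ (N ∷ D' ++ (E ∷ [])) ++ (E ∷ Y)

_≤T_ : Word → Word → Set
_≤T_ = Star Rot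

zeroHat : ℕ → Word
zeroHat n = concat (replicate n (N ∷ E ∷ []))

CoveredBy : ℕ → Word → Word → Set
CoveredBy n y x = Dyck n y × y ≤T x × ¬ (y ≡ x) ×
  (∀ z → Dyck n z → y ≤T z → z ≤T x → z ≡ y ⊎ z ≡ x)

IsMeet : ℕ → (Word → Set) → Word → Set
IsMeet n S m = Dyck n m × (∀ s → S s → m ≤T s) ×
  (∀ l → Dyck n l → (∀ s → S s → l ≤T s) → l ≤T m)

PopRel : ℕ → Word → Word → Set
PopRel n x y = IsMeet n (λ s → CoveredBy n s x ⊎ s ≡ x) y

data PopIter (n : ℕ) : ℕ → Word → Word → Set where
  done : ∀ {x} → PopIter n zero x x
  step : ∀ {t x x' y} → PopRel n x x' → PopIter n t x' y → PopIter n (suc t) x y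

Sortable : ℕ → ℕ → Word → Set
Sortable n t x = Dyck n x × PopIter n t x (zeroHat n)

HasCount : (Word → Set) → ℕ → Set
HasCount P k = Σ (List Word) λ L → Unique L ×
  (∀ w → w ∈ L → P w) × (∀ w → P w → w ∈ L) × length L ≡ k

Series : Set
Series = ℕ → ℤ

sumℤ : List ℤ → ℤ
sumℤ = foldr _+_ (+ 0)

_⊛_ : Series → Series → Series
(f ⊛ g) k = sumℤ (map (λ i → f i * g (k ∸ i)) (upTo (suc k)))

catalan : ℕ → ℕ
catalan m = ((m +ℕ m) C m) / suc m

zSeries : Series
zSeries (suc zero) = + 1
zSeries _          = + 0

denom : ℕ → Series
denom t zero          = + 1
denom t (suc zero)    = - (+ 2)
denom t (suc (suc j)) with suc (suc j) ≤? t
... | yes _ = - (+ catalan (suc j))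
... | no  _ = + 0

toSeries : (ℕ → ℕ) → Series
toSeries h zero    = + 0
toSeries h (suc n) = + h (suc n)

{-# OPTIONS --safe #-}

-- A Dyck path X · N Y E, with X and Y Dyck, is a binary tree with subtrees X and Y. Listing for each N
-- the number of N's it encloses turns the Tamari order into the componentwise order: if the code of s
-- lies strictly below that of t, some rotation of t still lies above s. Hence the lower covers are the
-- rotations, meets are componentwise minima, and Pop makes every node of the plane forest hand its last
-- child over as its right sibling. After one application of Pop each further one lowers every positive
-- code entry by 1, so a path is t-sortable iff every factor N A N B E E with A and B Dyck has fewer
-- than t N's in A. A nonempty such path is X N E, or arises from the shorter sortable path X N B E by
-- inserting an arbitrary A of semilength < t to give X N A N B E E; this is the recurrence for h_t.

module Submission where

open import Defs
open import Data.Nat using (ℕ; zero; suc; pred; _+_; _*_; _∸_; _≤_; _<_; _≤?_; z≤n; s≤s; s≤s⁻¹)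
open import Data.Nat.Combinatorics using (_C_; nC1≡n; nCk≡nC[n∸k]; nCk+nC[k+1]≡[n+1]C[k+1])
open import Data.Nat.DivMod using (_/_; m*n/n≡m)
open import Data.Nat.ListAction using (sum)
open import Data.Nat.ListAction.Properties using (sum-++)
open import Data.Nat.Properties
open import Data.Nat.Tactic.RingSolver using (solve-∀)
open import Data.Integer using (ℤ; -_) renaming (+_ to infix 8 ⁺_; _+_ to _+ᶻ_; _*_ to _*ᶻ_)
import Data.Integer.Properties as ℤ
open import Data.Integer.Tactic.RingSolver using () renaming (solve-∀ to ℤ-solve-∀)
open import Data.List using (List; []; _∷_; _++_; length; map; upTo)
open import Data.List.Membership.Propositional using (_∈_)
open import Data.List.Membership.Propositional.Properties
  using (∈-map⁺; ∈-map⁻; ∈-++⁺ˡ; ∈-++⁺ʳ; ∈-++⁻; ∈-upTo⁺; ∈-upTo⁻)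
open import Data.List.Membership.Propositional.Properties.WithK using (unique∧set⇒bag)
open import Data.List.Properties
  using (++-assoc; ++-identityʳ; length-++; length-map; map-++; map-∘; map-cong; map-id; upTo-∷ʳ)
open import Data.List.Relation.Binary.BagAndSetEquality using (∼bag⇒↭)
open import Data.List.Relation.Binary.Permutation.Propositional.Properties using (↭-length)
open import Data.List.Relation.Binary.Pointwise as Pointwise using (Pointwise; []; _∷_; Pointwise-length)
open import Data.List.Relation.Unary.All as All using (All; []; _∷_)
import Data.List.Relation.Unary.All.Properties as All
open import Data.List.Relation.Unary.AllPairs using ([]; _∷_)
open import Data.List.Relation.Unary.Any using (here; there)
open import Data.List.Relation.Unary.Unique.Propositional using (Unique)
import Data.List.Relation.Unary.Unique.Propositional.Properties as Unique
open import Data.Product using (Σ; ∃-syntax; _×_; _,_; proj₁; proj₂)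
open import Data.Sum as Sum using (_⊎_; inj₁; inj₂; [_,_])
open import Data.Sum.Properties using (inj₁-injective; inj₂-injective)
open import Data.Vec as Vec using (Vec; []; _∷_)
open import Function using (_∘_; mk⇔)
open import Relation.Nullary using (¬_; yes; no; contradiction)
open import Relation.Binary.PropositionalEquality hiding ([_])
open import Relation.Binary.Construct.Closure.ReflexiveTransitive using (ε; _◅_; _◅◅_)

-- Binary trees and Dyck words

data Tree : Set where
  leaf : Tree
  node : Tree → Tree → Tree

size : Tree → ℕ
size leaf       = 0
size (node p q) = size p + suc (size q)

word : Tree → Word
word leaf       = []
word (node p q) = word p ++ N ∷ word q ++ E ∷ []

infixl 6 _·_
-- Concatenation of plane forests: the leftmost leaf of the right argument is replaced by the left
-- argument, so that words and codes are concatenated.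
_·_ : Tree → Tree → Tree
t · leaf     = t
t · node a b = node (t · a) b

word-node-++ : ∀ p q R → word (node p q) ++ R ≡ word p ++ N ∷ word q ++ E ∷ R
word-node-++ p q R = begin
  (word p ++ N ∷ word q ++ E ∷ []) ++ R  ≡⟨ ++-assoc (word p) _ R ⟩
  word p ++ N ∷ (word q ++ E ∷ []) ++ R  ≡⟨ cong (λ u → word p ++ N ∷ u) (++-assoc (word q) _ R) ⟩
  word p ++ N ∷ word q ++ E ∷ R          ∎
  where open ≡-Reasoning

leaf-· : ∀ v → leaf · v ≡ v
leaf-· leaf       = refl
leaf-· (node x y) = cong (λ v → node v y) (leaf-· x)

size-· : ∀ s t → size (s · t) ≡ size s + size t
size-· s leaf       = sym (+-identityʳ (size s))
size-· s (node a b) = trans (cong (_+ suc (size b)) (size-· s a)) (+-assoc (size s) _ _)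

-- Heights at which a word may start so that it stays nonnegative and ends at height 0.
data Path : ℕ → Word → Set where
  []  : Path 0 []
  up  : ∀ {d w} → Path (suc d) w → Path d (N ∷ w)
  down : ∀ {d w} → Path d w → Path (suc d) (E ∷ w)

Path-count : ∀ {d w} → Path d w → countE w ≡ countN w + d
Path-count []       = refl
Path-count (up p)   = trans (Path-count p) (+-suc _ _)
Path-count (down p) = trans (cong suc (Path-count p)) (sym (+-suc _ _))

Path-prefix : ∀ {d w} → Path d w → ∀ u v → u ++ v ≡ w → countE u ≤ countN u + d
Path-prefix p        []      v eq   = z≤n
Path-prefix (up p)   (N ∷ u) v refl = ≤-trans (Path-prefix p u v refl) (≤-reflexive (+-suc _ _))
Path-prefix (down p) (E ∷ u) v refl = ≤-trans (s≤s (Path-prefix p u v refl)) (≤-reflexive (sym (+-suc _ _)))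

count⇒Path : ∀ d w → countE w ≡ countN w + d → (∀ u v → u ++ v ≡ w → countE u ≤ countN u + d) → Path d w
count⇒Path d [] eq pre with refl ← eq = []
count⇒Path d (N ∷ w) eq pre =
  up (count⇒Path (suc d) w (trans eq (sym (+-suc _ d)))
       λ u v eq′ → ≤-trans (pre (N ∷ u) v (cong (N ∷_) eq′)) (≤-reflexive (sym (+-suc _ d))))
count⇒Path zero (E ∷ w) eq pre with () ← pre (E ∷ []) w refl
count⇒Path (suc d) (E ∷ w) eq pre =
  down (count⇒Path d w (suc-injective (trans eq (+-suc _ d)))
         λ u v eq′ → s≤s⁻¹ (≤-trans (pre (E ∷ u) v (cong (E ∷_) eq′)) (≤-reflexive (+-suc _ d))))

Balanced⇒Path : ∀ {w} → Balanced w → Path 0 w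
Balanced⇒Path (eq , pre) =
  count⇒Path 0 _ (trans (sym eq) (sym (+-identityʳ _)))
    λ u v e → ≤-trans (pre u v e) (≤-reflexive (sym (+-identityʳ _)))

Path⇒Balanced : ∀ {w} → Path 0 w → Balanced w
Path⇒Balanced p =
  sym (trans (Path-count p) (+-identityʳ _)) ,
  λ u v e → ≤-trans (Path-prefix p u v e) (≤-reflexive (+-identityʳ _))

Path-word : ∀ t {d R} → Path d R → Path d (word t ++ R)
Path-word leaf       p = p
Path-word (node a b) {R = R} p =
  subst (Path _) (sym (word-node-++ a b R)) (Path-word a (up (Path-word b (down p))))

Path-of-tree : ∀ t → Path 0 (word t)
Path-of-tree t = subst (Path 0) (++-identityʳ _) (Path-word t [])

-- Stack parser: the stack holds the forests waiting to the left of each open N.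
-- On words that are not Dyck paths the result is meaningless.
parseWith : List Tree → Tree → Word → Tree
parseWith ts       t []      = t
parseWith ts       t (N ∷ w) = parseWith (t ∷ ts) leaf w
parseWith []       t (E ∷ w) = t
parseWith (p ∷ ts) t (E ∷ w) = parseWith ts (node p t) w

parse : Word → Tree
parse = parseWith [] leaf

parseWith-word : ∀ u ts t R → parseWith ts t (word u ++ R) ≡ parseWith ts (t · u) R
parseWith-word leaf       ts t R = refl
parseWith-word (node a b) ts t R = begin
  parseWith ts t (word (node a b) ++ R)               ≡⟨ cong (parseWith ts t) (word-node-++ a b R) ⟩
  parseWith ts t (word a ++ N ∷ word b ++ E ∷ R)      ≡⟨ parseWith-word a ts t _ ⟩
  parseWith (t · a ∷ ts) leaf (word b ++ E ∷ R)       ≡⟨ parseWith-word b _ leaf _ ⟩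
  parseWith ts (node (t · a) (leaf · b)) R            ≡⟨ cong (λ v → parseWith ts (node (t · a) v) R) (leaf-· b) ⟩
  parseWith ts (node (t · a) b) R                     ∎
  where open ≡-Reasoning

parse-word : ∀ t → parse (word t) ≡ t
parse-word t = begin
  parse (word t)         ≡⟨ cong parse (++-identityʳ (word t)) ⟨
  parse (word t ++ [])   ≡⟨ parseWith-word t [] leaf [] ⟩
  leaf · t               ≡⟨ leaf-· t ⟩
  t                      ∎
  where open ≡-Reasoning

-- The letters already read when the parser holds this stack: each waiting forest is followed by its
-- unmatched N.
stackWord : List Tree → Word
stackWord []       = []
stackWord (t ∷ ts) = stackWord ts ++ word t ++ N ∷ []

word-parseWith : ∀ ts t {w} → Path (length ts) w →
  word (parseWith ts t w) ≡ stackWord ts ++ word t ++ w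
word-parseWith []       t []       = sym (++-identityʳ _)
word-parseWith ts       t (up {w = w} p) = begin
  word (parseWith (t ∷ ts) leaf w)           ≡⟨ word-parseWith (t ∷ ts) leaf p ⟩
  (stackWord ts ++ word t ++ N ∷ []) ++ w    ≡⟨ ++-assoc (stackWord ts) _ w ⟩
  stackWord ts ++ (word t ++ N ∷ []) ++ w    ≡⟨ cong (stackWord ts ++_) (++-assoc (word t) _ w) ⟩
  stackWord ts ++ word t ++ N ∷ w            ∎
  where open ≡-Reasoning
word-parseWith (s ∷ ts) t (down {w = w} p) = begin
  word (parseWith ts (node s t) w)                   ≡⟨ word-parseWith ts (node s t) p ⟩
  stackWord ts ++ word (node s t) ++ w               ≡⟨ cong (stackWord ts ++_) (word-node-++ s t w) ⟩
  stackWord ts ++ word s ++ N ∷ word t ++ E ∷ w      ≡⟨ cong (stackWord ts ++_) (++-assoc (word s) (N ∷ []) _) ⟨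
  stackWord ts ++ (word s ++ N ∷ []) ++ word t ++ E ∷ w  ≡⟨ ++-assoc (stackWord ts) _ _ ⟨
  (stackWord ts ++ word s ++ N ∷ []) ++ word t ++ E ∷ w  ∎
  where open ≡-Reasoning

word-parse : ∀ {w} → Path 0 w → word (parse w) ≡ w
word-parse = word-parseWith [] leaf

word-injective : ∀ s t → word s ≡ word t → s ≡ t
word-injective s t eq = trans (sym (parse-word s)) (trans (cong parse eq) (parse-word t))

countN-word : ∀ t R → countN (word t ++ R) ≡ size t + countN R
countN-word leaf       R = refl
countN-word (node a b) R = begin
  countN (word (node a b) ++ R)               ≡⟨ cong countN (word-node-++ a b R) ⟩
  countN (word a ++ N ∷ word b ++ E ∷ R)      ≡⟨ countN-word a _ ⟩
  size a + suc (countN (word b ++ E ∷ R))     ≡⟨ cong (λ k → size a + suc k) (countN-word b _) ⟩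
  size a + (suc (size b) + countN R)          ≡⟨ +-assoc (size a) _ _ ⟨
  size a + suc (size b) + countN R            ∎
  where open ≡-Reasoning

size≡countN : ∀ t → countN (word t) ≡ size t
size≡countN t = begin
  countN (word t)        ≡⟨ cong countN (++-identityʳ (word t)) ⟨
  countN (word t ++ [])  ≡⟨ countN-word t [] ⟩
  size t + 0             ≡⟨ +-identityʳ _ ⟩
  size t                 ∎
  where open ≡-Reasoning

Dyck-word : ∀ t → Dyck (size t) (word t)
Dyck-word t with bal , pre ← Path⇒Balanced (Path-of-tree t) =
  size≡countN t , trans (sym bal) (size≡countN t) , pre

Dyck⇒tree : ∀ {n w} → Dyck n w → ∃[ t ] (size t ≡ n × w ≡ word t)
Dyck⇒tree {n} {w} (eN , eE , pre) =
  parse w , trans (sym (size≡countN (parse w))) (trans (cong countN eq) eN) , sym eq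
  where eq = word-parse (Balanced⇒Path (trans eN (sym eE) , pre))

-- The code of a tree lists, for each N of its word, the number of N's it encloses.
code : Tree → List ℕ
code leaf       = []
code (node p q) = code p ++ size q ∷ code q

enclosed : ℕ → Word → ℕ
enclosed d       []      = 0
enclosed d       (N ∷ w) = suc (enclosed (suc d) w)
enclosed zero    (E ∷ w) = 0
enclosed (suc d) (E ∷ w) = enclosed d w

codes : Word → List ℕ
codes []      = []
codes (N ∷ w) = enclosed 0 w ∷ codes w
codes (E ∷ w) = codes w

enclosed-word : ∀ t d R → enclosed d (word t ++ R) ≡ size t + enclosed d R
enclosed-word leaf       d R = refl
enclosed-word (node a b) d R = begin
  enclosed d (word (node a b) ++ R)                ≡⟨ cong (enclosed d) (word-node-++ a b R) ⟩
  enclosed d (word a ++ N ∷ word b ++ E ∷ R)       ≡⟨ enclosed-word a d _ ⟩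
  size a + suc (enclosed (suc d) (word b ++ E ∷ R))  ≡⟨ cong (λ k → size a + suc k) (enclosed-word b (suc d) _) ⟩
  size a + (suc (size b) + enclosed d R)           ≡⟨ +-assoc (size a) _ _ ⟨
  size a + suc (size b) + enclosed d R             ∎
  where open ≡-Reasoning

codes-word-++ : ∀ t R → codes (word t ++ R) ≡ code t ++ codes R
codes-word-++ leaf       R = refl
codes-word-++ (node a b) R = begin
  codes (word (node a b) ++ R)                ≡⟨ cong codes (word-node-++ a b R) ⟩
  codes (word a ++ N ∷ word b ++ E ∷ R)       ≡⟨ codes-word-++ a _ ⟩
  code a ++ enclosed 0 (word b ++ E ∷ R) ∷ codes (word b ++ E ∷ R)
    ≡⟨ cong₂ (λ k v → code a ++ k ∷ v) (trans (enclosed-word b 0 _) (+-identityʳ _)) (codes-word-++ b _) ⟩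
  code a ++ (size b ∷ code b) ++ codes R      ≡⟨ ++-assoc (code a) _ _ ⟨
  (code a ++ size b ∷ code b) ++ codes R      ∎
  where open ≡-Reasoning

codes-word : ∀ t → codes (word t) ≡ code t
codes-word t = begin
  codes (word t)        ≡⟨ cong codes (++-identityʳ (word t)) ⟨
  codes (word t ++ [])  ≡⟨ codes-word-++ t [] ⟩
  code t ++ []          ≡⟨ ++-identityʳ _ ⟩
  code t                ∎
  where open ≡-Reasoning

length-code : ∀ t → length (code t) ≡ size t
length-code leaf       = refl
length-code (node p q) =
  trans (length-++ (code p)) (cong₂ (λ m n → m + suc n) (length-code p) (length-code q))

-- Rotations of words raise the code

infix 4 _⊑_
_⊑_ : List ℕ → List ℕ → Set
_⊑_ = Pointwise _≤_

⊑-refl : ∀ {xs} → xs ⊑ xs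
⊑-refl = Pointwise.refl ≤-refl

⊑-trans : ∀ {xs ys zs} → xs ⊑ ys → ys ⊑ zs → xs ⊑ zs
⊑-trans = Pointwise.transitive ≤-trans

⊑-antisym : ∀ {xs ys} → xs ⊑ ys → ys ⊑ xs → xs ≡ ys
⊑-antisym p q = Pointwise.Pointwise-≡⇒≡ (Pointwise.antisymmetric ≤-antisym p q)

-- If the moved E matches the N being measured (`d` is 0), the count is 0 before the move and can
-- only grow; otherwise both scans cross this E and the balanced block, in either order, with the
-- same total.
rotate-enclosed : ∀ t Y d →
  enclosed d (E ∷ (N ∷ word t ++ E ∷ []) ++ Y) ≤ enclosed d ((N ∷ word t ++ E ∷ []) ++ E ∷ Y)
rotate-enclosed t Y zero    = z≤n
rotate-enclosed t Y (suc d)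
  rewrite ++-assoc (word t) (E ∷ []) Y | ++-assoc (word t) (E ∷ []) (E ∷ Y)
        | enclosed-word t (suc d) (E ∷ Y) | enclosed-word t (suc (suc d)) (E ∷ E ∷ Y) = ≤-refl

rotate-codes : ∀ t Y → codes (E ∷ (N ∷ word t ++ E ∷ []) ++ Y) ≡ codes ((N ∷ word t ++ E ∷ []) ++ E ∷ Y)
rotate-codes t Y
  rewrite ++-assoc (word t) (E ∷ []) Y | ++-assoc (word t) (E ∷ []) (E ∷ Y)
        | enclosed-word t 0 (E ∷ Y) | enclosed-word t 0 (E ∷ E ∷ Y)
        | codes-word-++ t (E ∷ Y) | codes-word-++ t (E ∷ E ∷ Y) = refl

module _ {A B : Word} (enc : ∀ d → enclosed d A ≤ enclosed d B) where

  enclosed-++-mono : ∀ X d → enclosed d (X ++ A) ≤ enclosed d (X ++ B)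
  enclosed-++-mono []      d       = enc d
  enclosed-++-mono (N ∷ X) d       = s≤s (enclosed-++-mono X (suc d))
  enclosed-++-mono (E ∷ X) zero    = z≤n
  enclosed-++-mono (E ∷ X) (suc d) = enclosed-++-mono X d

  codes-++-mono : ∀ X → codes A ≡ codes B → codes (X ++ A) ⊑ codes (X ++ B)
  codes-++-mono []      eq = subst (codes A ⊑_) eq ⊑-refl
  codes-++-mono (N ∷ X) eq = enclosed-++-mono X 0 ∷ codes-++-mono X eq
  codes-++-mono (E ∷ X) eq = codes-++-mono X eq

Rot⇒⊑ : ∀ {μ μ'} → Rot μ μ' → codes μ ⊑ codes μ'
Rot⇒⊑ (X , Y , D , bal , refl , refl)
  with parse D | word-parse (Balanced⇒Path bal)
... | t | refl = codes-++-mono (rotate-enclosed t Y) X (rotate-codes t Y)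

≤T⇒⊑ : ∀ {μ μ'} → μ ≤T μ' → codes μ ⊑ codes μ'
≤T⇒⊑ ε       = ⊑-refl
≤T⇒⊑ (r ◅ s) = ⊑-trans (Rot⇒⊑ r) (≤T⇒⊑ s)

≤T-word⇒⊑ : ∀ s t → word s ≤T word t → code s ⊑ code t
≤T-word⇒⊑ s t le = subst₂ _⊑_ (codes-word s) (codes-word t) (≤T⇒⊑ le)

-- The Tamari order on codes

-- The three positions that `y` may take when `xs ++ y ∷ ys` is compared entrywise with
-- `us ++ v ∷ vs`: opposite `v`, inside `us` or inside `vs`.
data Align (xs : List ℕ) (y : ℕ) (ys us : List ℕ) (v : ℕ) (vs : List ℕ) : Set where
  same   : xs ⊑ us → y ≤ v → ys ⊑ vs → Align xs y ys us v vs
  before : ∀ {us₁ u us₂} → us ≡ us₁ ++ u ∷ us₂ → y ≤ u → ys ⊑ us₂ ++ v ∷ vs → Align xs y ys us v vs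
  after  : ∀ {vs₁ w vs₂} → vs ≡ vs₁ ++ w ∷ vs₂ → xs ⊑ us ++ v ∷ vs₁ → y ≤ w → ys ⊑ vs₂ → Align xs y ys us v vs

⊑-split : ∀ xs {y ys zs} → xs ++ y ∷ ys ⊑ zs →
  ∃[ zs₁ ] ∃[ z ] ∃[ zs₂ ] (zs ≡ zs₁ ++ z ∷ zs₂ × xs ⊑ zs₁ × y ≤ z × ys ⊑ zs₂)
⊑-split []       (l ∷ ls) = [] , _ , _ , refl , [] , l , ls
⊑-split (x ∷ xs) (l ∷ ls) with zs₁ , z , zs₂ , refl , lxs , ly , lys ← ⊑-split xs ls =
  _ ∷ zs₁ , z , zs₂ , refl , l ∷ lxs , ly , lys

align : ∀ xs {y ys} us {v vs} → xs ++ y ∷ ys ⊑ us ++ v ∷ vs → Align xs y ys us v vs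
align []       []       (l ∷ ls) = same [] l ls
align []       (u ∷ us) (l ∷ ls) = before {us₁ = []} refl l ls
align (x ∷ xs) []       (l ∷ ls) with vs₁ , w , vs₂ , eq , lxs , ly , lys ← ⊑-split xs ls =
  after {vs₁ = vs₁} eq (l ∷ lxs) ly lys
align (x ∷ xs) (u ∷ us) (l ∷ ls) with align xs us ls
... | same lxs ly lys         = same (l ∷ lxs) ly lys
... | before {us₁} eq ly lys  = before {us₁ = u ∷ us₁} (cong (u ∷_) eq) ly lys
... | after {vs₁} eq lxs ly lys = after {vs₁ = vs₁} eq (l ∷ lxs) ly lys

⊑-++⁻ : ∀ xs {y ys} us {v vs} → length xs ≡ length us → xs ++ y ∷ ys ⊑ us ++ v ∷ vs →
  xs ⊑ us × y ≤ v × ys ⊑ vs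
⊑-++⁻ []       []       eq (l ∷ ls) = [] , l , ls
⊑-++⁻ (x ∷ xs) (u ∷ us) eq (l ∷ ls) with lxs , rest ← ⊑-++⁻ xs us (suc-injective eq) ls = l ∷ lxs , rest

-- A necessary condition on codes: an N encloses only N's to its right. It limits the reach of an
-- entry of a code that is a prefix of a longer list.
data Nested : List ℕ → Set where
  []  : Nested []
  _∷_ : ∀ {k ks} → k ≤ length ks → Nested ks → Nested (k ∷ ks)

Nested-++ : ∀ {xs ys} → Nested xs → Nested ys → Nested (xs ++ ys)
Nested-++ []             ny = ny
Nested-++ {xs = _ ∷ xs} {ys} (le ∷ nx) ny =
  ≤-trans le (≤-trans (m≤m+n (length xs) (length ys)) (≤-reflexive (sym (length-++ xs)))) ∷ Nested-++ nx ny

Nested-entry : ∀ us {k ks} → Nested (us ++ k ∷ ks) → k ≤ length ks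
Nested-entry []       (le ∷ _)  = le
Nested-entry (u ∷ us) (_ ∷ nst) = Nested-entry us nst

Nested-code : ∀ t → Nested (code t)
Nested-code leaf       = []
Nested-code (node p q) = Nested-++ (Nested-code p) (≤-reflexive (sym (length-code q)) ∷ Nested-code q)

code-· : ∀ s t → code (s · t) ≡ code s ++ code t
code-· s leaf       = sym (++-identityʳ (code s))
code-· s (node a b) = trans (cong (_++ size b ∷ code b) (code-· s a)) (++-assoc (code s) _ _)

code-node-· : ∀ p q r → code (node p q · r) ≡ code p ++ size q ∷ code (q · r)
code-node-· p q r = begin
  code (node p q · r)                    ≡⟨ code-· (node p q) r ⟩
  (code p ++ size q ∷ code q) ++ code r  ≡⟨ ++-assoc (code p) _ _ ⟩
  code p ++ size q ∷ code q ++ code r    ≡⟨ cong (λ v → code p ++ size q ∷ v) (code-· q r) ⟨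
  code p ++ size q ∷ code (q · r)        ∎
  where open ≡-Reasoning

⊑-node : ∀ {xs ys us vs m n} → xs ⊑ us → m ≤ n → ys ⊑ vs → xs ++ m ∷ ys ⊑ us ++ n ∷ vs
⊑-node lxs l lys = Pointwise.++⁺ lxs (l ∷ lys)

⊑⇒size≡ : ∀ s t → code s ⊑ code t → size s ≡ size t
⊑⇒size≡ s t le = trans (sym (length-code s)) (trans (Pointwise-length le) (length-code t))

-- An N of `s` opposite an entry of `code p` encloses at most what is left of `code p`, so no
-- earlier N encloses the one opposite `k`. The latter is therefore a root of the forest `s`, which
-- splits there into `s₁` on the left, the interior `s₂` and the rest `s₃`. The recursion looks for
-- this root from the right.
⊑-unnode : ∀ s p {k v} → code s ⊑ code p ++ k ∷ v →
  ∃[ s₁ ] ∃[ s₂ ] ∃[ s₃ ] (s ≡ node s₁ s₂ · s₃ × code s₁ ⊑ code p × code (s₂ · s₃) ⊑ v)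
⊑-unnode leaf p le =
  contradiction (trans (trans (Pointwise-length le) (length-++ (code p))) (+-suc (length (code p)) _)) 0≢1+n
⊑-unnode (node a b) p {k} {v} le with align (code a) (code p) le
... | same la _ lb = a , b , leaf , refl , la , lb
-- The last root of `s` would stand opposite an entry of `code p` and yet enclose everything after
-- it, including the N opposite `k`.
... | before {us₁} {u} {us₂} eq b≤u lb = contradiction size-b≤ (<⇒≱ size-b>)
  where
  size-b≤ : size b ≤ length us₂
  size-b≤ = ≤-trans b≤u (Nested-entry us₁ (subst Nested eq (Nested-code p)))
  size-b> : length us₂ < size b
  size-b> = begin
    suc (length us₂)               ≤⟨ s≤s (m≤m+n _ _) ⟩
    suc (length us₂ + length v)    ≡⟨ +-suc (length us₂) (length v) ⟨
    length us₂ + suc (length v)    ≡⟨ length-++ us₂ ⟨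
    length (us₂ ++ k ∷ v)          ≡⟨ Pointwise-length lb ⟨
    length (code b)                ≡⟨ length-code b ⟩
    size b                         ∎
    where open ≤-Reasoning
... | after eq la b≤w lb with s₁ , s₂ , s₃ , refl , l₁ , l₂ ← ⊑-unnode a p la =
  s₁ , s₂ , node s₃ b , refl , l₁ , subst (_ ⊑_) (sym eq) (⊑-node l₂ b≤w lb)

-- Tree rotations and cover relations

infix 4 _⋖_
-- In words, `rotate` turns p N a E N b E into p N a N b E E; only one code entry changes, from
-- `size a` to `size (node a b)`.
data _⋖_ : Tree → Tree → Set where
  rotate : ∀ {p a b} → node (node p a) b ⋖ node p (node a b)
  left   : ∀ {p p′ q} → p ⋖ p′ → node p q ⋖ node p′ q
  right  : ∀ {p q q′} → q ⋖ q′ → node p q ⋖ node p q′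

⋖⇒⊑ : ∀ {s t} → s ⋖ t → code s ⊑ code t
⋖⇒⊑ (rotate {p} {a} {b}) = subst (_⊑ code (node p (node a b))) (sym (++-assoc (code p) _ _))
  (⊑-node {xs = code p} ⊑-refl (m≤m+n (size a) _) ⊑-refl)
⋖⇒⊑ (left r)             = ⊑-node (⋖⇒⊑ r) ≤-refl ⊑-refl
⋖⇒⊑ (right {p} {q} {q′} r)      = ⊑-node {xs = code p} ⊑-refl (≤-reflexive (⊑⇒size≡ q q′ (⋖⇒⊑ r))) (⋖⇒⊑ r)

weight : Tree → ℕ
weight = sum ∘ code

weight-node : ∀ p q → weight (node p q) ≡ weight p + (size q + weight q)
weight-node p q = sum-++ (code p) _

sum-mono : ∀ {xs ys} → xs ⊑ ys → sum xs ≤ sum ys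
sum-mono []       = z≤n
sum-mono (l ∷ ls) = +-mono-≤ l (sum-mono ls)

⋖⇒weight< : ∀ {s t} → s ⋖ t → weight s < weight t
⋖⇒weight< (rotate {p} {a} {b}) = begin-strict
  weight (node (node p a) b)                              ≡⟨ weight-node (node p a) b ⟩
  weight (node p a) + (size b + weight b)                 ≡⟨ cong (_+ (size b + weight b)) (weight-node p a) ⟩
  weight p + (size a + weight a) + (size b + weight b)    ≡⟨ +-assoc (weight p) _ _ ⟩
  weight p + (size a + weight a + (size b + weight b))    ≡⟨ cong (weight p +_) (+-assoc (size a) _ _) ⟩
  weight p + (size a + (weight a + (size b + weight b)))  ≡⟨ cong (λ k → weight p + (size a + k)) (weight-node a b) ⟨
  weight p + (size a + weight (node a b))
    <⟨ +-monoʳ-< (weight p) (+-monoˡ-< (weight (node a b)) (m<m+n (size a) (s≤s z≤n))) ⟩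
  weight p + (size (node a b) + weight (node a b))        ≡⟨ weight-node p (node a b) ⟨
  weight (node p (node a b))                              ∎
  where open ≤-Reasoning
⋖⇒weight< (left {p} {p′} {q} r) =
  subst₂ _<_ (sym (weight-node p q)) (sym (weight-node p′ q)) (+-monoˡ-< _ (⋖⇒weight< r))
⋖⇒weight< (right {p} {q} {q′} r) =
  subst₂ _<_ (sym (weight-node p q)) (sym (weight-node p q′))
    (+-monoʳ-< (weight p) (+-mono-≤-< (≤-reflexive (⊑⇒size≡ q q′ (⋖⇒⊑ r))) (⋖⇒weight< r)))

-- Cut `s` at the N opposite the root entry of `t`. If the part before or the part after it is
-- strictly smaller, a rotation inside the corresponding subtree of `t` serves; if both agree, only
-- the E matching the root N can differ.
⊑⇒≡⊎below : ∀ s t → code s ⊑ code t → s ≡ t ⊎ ∃[ z ] (z ⋖ t × code s ⊑ code z)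
⊑⇒≡⊎below leaf       leaf le = inj₁ refl
⊑⇒≡⊎below (node a b) leaf le with code a | le
... | []    | ()
... | _ ∷ _ | ()
⊑⇒≡⊎below s (node p q) le with s₁ , s₂ , s₃ , refl , l₁ , l₂ ← ⊑-unnode s p le
  with ⊑⇒≡⊎below s₁ p l₁ | ⊑⇒≡⊎below (s₂ · s₃) q l₂
... | inj₂ (z , z⋖p , l) | _ = inj₂ (node z q , left z⋖p ,
      subst (_⊑ _) (sym (code-node-· s₁ s₂ s₃)) (⊑-node l s₂≤q l₂))
  where
  s₂≤q : size s₂ ≤ size q
  s₂≤q = ≤-trans (m≤m+n (size s₂) (size s₃)) (≤-reflexive (trans (sym (size-· s₂ s₃)) (⊑⇒size≡ (s₂ · s₃) q l₂)))
... | inj₁ refl | inj₂ (z , z⋖q , l) = inj₂ (node p z , right z⋖q ,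
      subst (_⊑ _) (sym (code-node-· s₁ s₂ s₃)) (⊑-node l₁ s₂≤z l))
  where
  s₂≤z : size s₂ ≤ size z
  s₂≤z = ≤-trans (m≤m+n (size s₂) (size s₃)) (≤-reflexive (trans (sym (size-· s₂ s₃)) (⊑⇒size≡ (s₂ · s₃) z l)))
... | inj₁ refl | inj₁ refl = absorb s₃
  where
  -- In `s` the root N is closed after `s₂`, in `t` only after `s₃`. Moving that E of `t` back
  -- across the last component of `s₃` undoes one rotation and stays above `s`.
  absorb : ∀ s₃ → node p s₂ · s₃ ≡ node p (s₂ · s₃) ⊎
    ∃[ z ] (z ⋖ node p (s₂ · s₃) × code (node p s₂ · s₃) ⊑ code z)
  absorb leaf       = inj₁ refl
  absorb (node c d) = inj₂ (node (node p (s₂ · c)) d , rotate ,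
    Pointwise.++⁺ (subst (_⊑ code (node p (s₂ · c))) (sym (code-node-· p s₂ c))
      (⊑-node {xs = code p} ⊑-refl s₂≤ ⊑-refl)) ⊑-refl)
    where
    s₂≤ : size s₂ ≤ size (s₂ · c)
    s₂≤ = ≤-trans (m≤m+n (size s₂) (size c)) (≤-reflexive (sym (size-· s₂ c)))

code-injective : ∀ s t → code s ≡ code t → s ≡ t
code-injective s t eq with ⊑⇒≡⊎below s t (subst (code s ⊑_) eq ⊑-refl)
... | inj₁ s≡t           = s≡t
... | inj₂ (z , z⋖t , le) =
  contradiction (sum-mono le) (<⇒≱ (subst (weight z <_) (cong sum (sym eq)) (⋖⇒weight< z⋖t)))

⊑-code-antisym : ∀ s t → code s ⊑ code t → code t ⊑ code s → s ≡ t
⊑-code-antisym s t l l′ = code-injective s t (⊑-antisym l l′)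

Rot-++ : ∀ U V {μ μ'} → Rot μ μ' → Rot (U ++ μ ++ V) (U ++ μ' ++ V)
Rot-++ U V (X , Y , D , bal , refl , refl) =
  U ++ X , Y ++ V , D , bal , reassoc (E ∷ N ∷ D ++ E ∷ []) Y , reassoc (N ∷ D ++ E ∷ []) (E ∷ Y)
  where
  open ≡-Reasoning
  reassoc : ∀ A B → U ++ (X ++ A ++ B) ++ V ≡ (U ++ X) ++ A ++ B ++ V
  reassoc A B = begin
    U ++ (X ++ A ++ B) ++ V    ≡⟨ cong (U ++_) (++-assoc X _ V) ⟩
    U ++ X ++ (A ++ B) ++ V    ≡⟨ cong (λ W → U ++ X ++ W) (++-assoc A B V) ⟩
    U ++ X ++ A ++ B ++ V      ≡⟨ ++-assoc U X _ ⟨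
    (U ++ X) ++ A ++ B ++ V    ∎

⋖⇒Rot : ∀ {s t} → s ⋖ t → Rot (word s) (word t)
⋖⇒Rot (rotate {p} {a} {b}) =
  word p ++ N ∷ word a , [] , word b , Path⇒Balanced (Path-of-tree b) , eq₁ , eq₂
  where
  open ≡-Reasoning
  eq₁ : word (node (node p a) b) ≡ (word p ++ N ∷ word a) ++ (E ∷ N ∷ word b ++ E ∷ []) ++ []
  eq₁ = begin
    word (node p a) ++ N ∷ word b ++ E ∷ []                  ≡⟨ word-node-++ p a _ ⟩
    word p ++ N ∷ word a ++ E ∷ N ∷ word b ++ E ∷ []         ≡⟨ ++-assoc (word p) _ _ ⟨
    (word p ++ N ∷ word a) ++ E ∷ N ∷ word b ++ E ∷ []       ≡⟨ cong ((word p ++ N ∷ word a) ++_) (++-identityʳ _) ⟨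
    (word p ++ N ∷ word a) ++ (E ∷ N ∷ word b ++ E ∷ []) ++ []  ∎
  eq₂ : word (node p (node a b)) ≡ (word p ++ N ∷ word a) ++ (N ∷ word b ++ E ∷ []) ++ E ∷ []
  eq₂ = begin
    word p ++ N ∷ (word a ++ N ∷ word b ++ E ∷ []) ++ E ∷ []   ≡⟨ cong (λ W → word p ++ N ∷ W) (++-assoc (word a) _ _) ⟩
    word p ++ N ∷ word a ++ (N ∷ word b ++ E ∷ []) ++ E ∷ []   ≡⟨ ++-assoc (word p) _ _ ⟨
    (word p ++ N ∷ word a) ++ (N ∷ word b ++ E ∷ []) ++ E ∷ []  ∎
⋖⇒Rot (left {q = q} r)  = Rot-++ [] (N ∷ word q ++ E ∷ []) (⋖⇒Rot r)
⋖⇒Rot (right {p} {q} {q′} r) =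
  subst₂ Rot (++-assoc (word p) _ _) (++-assoc (word p) _ _)
    (Rot-++ (word p ++ N ∷ []) (E ∷ []) (⋖⇒Rot r))

-- Rotations that descend from `t` while staying above `s` lower the weight each time, so they come
-- to an end, and only `s` can be the end. The argument `n` of `go` bounds the weight and makes the
-- recursion structural.
⊑⇒≤T : ∀ s t → code s ⊑ code t → word s ≤T word t
⊑⇒≤T s t = go (suc (weight t)) t ≤-refl
  where
  go : ∀ n t → weight t < n → code s ⊑ code t → word s ≤T word t
  go (suc n) t (s≤s w≤n) le with ⊑⇒≡⊎below s t le
  ... | inj₁ refl            = ε
  ... | inj₂ (z , z⋖t , le′) = go n z (≤-trans (⋖⇒weight< z⋖t) w≤n) le′ ◅◅ (⋖⇒Rot z⋖t ◅ ε)

⋖⇒⋣ : ∀ {s t} → s ⋖ t → ¬ code t ⊑ code s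
⋖⇒⋣ r le = <⇒≱ (⋖⇒weight< r) (sum-mono le)

⋖⇒size≡ : ∀ {s t} → s ⋖ t → size s ≡ size t
⋖⇒size≡ {s} {t} r = ⊑⇒size≡ s t (⋖⇒⊑ r)

⊑-node⁻ : ∀ s t {m n xs ys} → size s ≡ size t → code s ++ m ∷ xs ⊑ code t ++ n ∷ ys →
  code s ⊑ code t × m ≤ n × xs ⊑ ys
⊑-node⁻ s t eq = ⊑-++⁻ (code s) (code t) (trans (length-code s) (trans eq (sym (length-code t))))

code-rotated : ∀ p a b → code (node (node p a) b) ≡ code p ++ size a ∷ code (node a b)
code-rotated p a b = ++-assoc (code p) _ _

-- Each rotation of `x` lowers one entry of its code and different rotations lower different
-- entries, so neither of two lies below the other. Cutting the codes at the position of the root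
-- entry of `x` separates the cases.
lower-covers-antichain : ∀ {y z x} → y ⋖ x → z ⋖ x → code y ⊑ code z → y ≡ z
lower-covers-antichain rotate rotate le = refl
lower-covers-antichain (rotate {p} {a} {b}) (left {p = z} r) le
  with l , _ ← ⊑-node⁻ p z (sym (⋖⇒size≡ r)) (subst (_⊑ code (node z (node a b))) (code-rotated p a b) le) =
  contradiction l (⋖⇒⋣ r)
lower-covers-antichain (rotate {p} {a} {b}) (right {q = z} r) le
  with _ , _ , l ← ⊑-node⁻ p p refl (subst (_⊑ code (node p z)) (code-rotated p a b) le) =
  contradiction l (⋖⇒⋣ r)
lower-covers-antichain (left {p = y} r) (rotate {p} {a} {b}) le
  with _ , l , _ ← ⊑-node⁻ y p (⋖⇒size≡ r) (subst (code (node y (node a b)) ⊑_) (code-rotated p a b) le) =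
  contradiction l (m+1+n≰m (size a))
lower-covers-antichain (right {q = y} r) (rotate {p} {a} {b}) le
  with _ , l , _ ← ⊑-node⁻ p p refl (subst (code (node p y) ⊑_) (code-rotated p a b) le) =
  contradiction (subst (_≤ size a) (⋖⇒size≡ r) l) (m+1+n≰m (size a))
lower-covers-antichain (left {p = y} r) (left {p = z} r′) le
  with l , _ ← ⊑-node⁻ y z (trans (⋖⇒size≡ r) (sym (⋖⇒size≡ r′))) le =
  cong (λ p → node p _) (lower-covers-antichain r r′ l)
lower-covers-antichain (left {p = y} {p′ = p} r) (right r′) le
  with _ , _ , l ← ⊑-node⁻ y p (⋖⇒size≡ r) le = contradiction l (⋖⇒⋣ r′)
lower-covers-antichain (right {p = p} r) (left {p = z} r′) le
  with l , _ ← ⊑-node⁻ p z (sym (⋖⇒size≡ r′)) le = contradiction l (⋖⇒⋣ r′)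
lower-covers-antichain (right {p = p} r) (right r′) le
  with _ , _ , l ← ⊑-node⁻ p p refl le = cong (node p) (lower-covers-antichain r r′ l)

⋖⇒word≢ : ∀ {s t} → s ⋖ t → word s ≢ word t
⋖⇒word≢ {s} {t} r eq = <⇒≢ (⋖⇒weight< r) (cong weight (word-injective s t eq))

-- A tree of the interval other than `t` lies below some rotation of `t`; this rotation is then
-- above `s`, and the antichain property identifies it with `s`.
⋖⇒CoveredBy : ∀ {s t} → s ⋖ t → CoveredBy (size t) (word s) (word t)
⋖⇒CoveredBy {s} {t} r =
  subst (λ n → Dyck n (word s)) (⋖⇒size≡ r) (Dyck-word s) ,
  ⋖⇒Rot r ◅ ε ,
  ⋖⇒word≢ r ,
  between
  where
  between : ∀ z → Dyck (size t) z → word s ≤T z → z ≤T word t → z ≡ word s ⊎ z ≡ word t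
  between z dz s≤z z≤t with u , _ , refl ← Dyck⇒tree dz
    with ⊑⇒≡⊎below u t (≤T-word⇒⊑ u t z≤t)
  ... | inj₁ refl = inj₂ refl
  ... | inj₂ (v , v⋖t , u⊑v)
    with refl ← lower-covers-antichain r v⋖t (⊑-trans (≤T-word⇒⊑ s u s≤z) u⊑v) =
    inj₁ (cong word (⊑-code-antisym u v u⊑v (≤T-word⇒⊑ s u s≤z)))

CoveredBy⇒⋖ : ∀ {n y t} → size t ≡ n → CoveredBy n y (word t) → ∃[ s ] (s ⋖ t × y ≡ word s)
CoveredBy⇒⋖ {t = t} refl (dy , y≤t , y≢t , btw) with s , _ , refl ← Dyck⇒tree dy
  with ⊑⇒≡⊎below s t (≤T-word⇒⊑ s t y≤t)
... | inj₁ refl = contradiction refl y≢t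
... | inj₂ (z , z⋖t , s⊑z)
  with btw (word z) (subst (λ n → Dyck n (word z)) (⋖⇒size≡ z⋖t) (Dyck-word z)) (⊑⇒≤T s z s⊑z) (⋖⇒Rot z⋖t ◅ ε)
... | inj₁ eq = z , z⋖t , sym eq
... | inj₂ eq = contradiction eq (⋖⇒word≢ z⋖t)

-- The Pop operator

-- Every node with children passes its last child on to become its right sibling;
-- popOnto F q is what F N q E becomes when F has been treated already.
pop     : Tree → Tree
popOnto : Tree → Tree → Tree
pop leaf              = leaf
pop (node p q)        = popOnto (pop p) q
popOnto F leaf        = node F leaf
popOnto F (node a b)  = popOnto (node F (pop a)) b

-- The number of N's outside the last component of the forest, which is the component that Pop hands
-- over.
leftSize : Tree → ℕ
leftSize leaf       = 0
leftSize (node a b) = size a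

leftSize≤size : ∀ t → leftSize t ≤ size t
leftSize≤size leaf       = z≤n
leftSize≤size (node a b) = m≤m+n (size a) _

size-pop     : ∀ t → size (pop t) ≡ size t
size-popOnto : ∀ F q → size (popOnto F q) ≡ size F + suc (size q)
size-pop leaf             = refl
size-pop (node p q)       = trans (size-popOnto (pop p) q) (cong (_+ suc (size q)) (size-pop p))
size-popOnto F leaf       = refl
size-popOnto F (node a b) = begin
  size (popOnto (node F (pop a)) b)          ≡⟨ size-popOnto (node F (pop a)) b ⟩
  size F + suc (size (pop a)) + suc (size b) ≡⟨ +-assoc (size F) _ _ ⟩
  size F + suc (size (pop a) + suc (size b)) ≡⟨ cong (λ k → size F + suc (k + suc (size b))) (size-pop a) ⟩
  size F + suc (size a + suc (size b))       ∎
  where open ≡-Reasoning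

-- Pop keeps the N's in their order. The interior `q` of an N loses its last component and nothing
-- else, so the entry becomes `leftSize q`.
code-popOnto : ∀ F q → code (popOnto F q) ≡ code F ++ leftSize q ∷ code (pop q)
code-popOnto F leaf       = refl
code-popOnto F (node a b) = begin
  code (popOnto (node F (pop a)) b)
    ≡⟨ code-popOnto (node F (pop a)) b ⟩
  (code F ++ size (pop a) ∷ code (pop a)) ++ leftSize b ∷ code (pop b)
    ≡⟨ ++-assoc (code F) _ _ ⟩
  code F ++ size (pop a) ∷ code (pop a) ++ leftSize b ∷ code (pop b)
    ≡⟨ cong₂ (λ k v → code F ++ k ∷ v) (size-pop a) (sym (code-popOnto (pop a) b)) ⟩
  code F ++ size a ∷ code (popOnto (pop a) b)
    ∎
  where open ≡-Reasoning

code-pop : ∀ p q → code (pop (node p q)) ≡ code (pop p) ++ leftSize q ∷ code (pop q)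
code-pop p q = code-popOnto (pop p) q

pop-⊑ : ∀ t → code (pop t) ⊑ code t
pop-⊑ leaf       = []
pop-⊑ (node p q) =
  subst (_⊑ code (node p q)) (sym (code-pop p q)) (⊑-node (pop-⊑ p) (leftSize≤size q) (pop-⊑ q))

pop-⊑-⋖ : ∀ {z t} → z ⋖ t → code (pop t) ⊑ code z
pop-⊑-⋖ (rotate {p} {a} {b}) =
  subst₂ _⊑_ (sym (code-pop p (node a b))) (sym (code-rotated p a b))
    (⊑-node (pop-⊑ p) ≤-refl (pop-⊑ (node a b)))
pop-⊑-⋖ (left {z} {p} {q} r) =
  subst (_⊑ code (node z q)) (sym (code-pop p q)) (⊑-node (pop-⊑-⋖ r) (leftSize≤size q) (pop-⊑ q))
pop-⊑-⋖ (right {p} {z} {q} r) =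
  subst (_⊑ code (node p z)) (sym (code-pop p q))
    (⊑-node (pop-⊑ p) (≤-trans (leftSize≤size q) (≤-reflexive (sym (⋖⇒size≡ r)))) (pop-⊑-⋖ r))

⊑-splitʳ : ∀ us {zs v vs} → zs ⊑ us ++ v ∷ vs →
  ∃[ zs₁ ] ∃[ z ] ∃[ zs₂ ] (zs ≡ zs₁ ++ z ∷ zs₂ × zs₁ ⊑ us × z ≤ v × zs₂ ⊑ vs)
⊑-splitʳ []       (l ∷ ls) = [] , _ , _ , refl , [] , l , ls
⊑-splitʳ (u ∷ us) (l ∷ ls) with zs₁ , z , zs₂ , refl , l₁ , lz , l₂ ← ⊑-splitʳ us ls =
  _ ∷ zs₁ , z , zs₂ , refl , l ∷ l₁ , lz , l₂

-- The rotation at a node with children lowers its entry to exactly `leftSize`, the value after Pop,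
-- so a common lower bound of all rotations respects every entry. With `v` an arbitrary list, the
-- induction can cut it at the root without showing that the pieces are codes.
pop-greatest : ∀ t v → v ⊑ code t → (∀ {z} → z ⋖ t → v ⊑ code z) → v ⊑ code (pop t)
pop-greatest leaf       v le below = le
pop-greatest (node p q) v le below with v₁ , k , v₂ , refl , l₁ , lk , l₂ ← ⊑-splitʳ (code p) le =
  subst (v ⊑_) (sym (code-pop p q))
    (⊑-node (pop-greatest p v₁ l₁ below-left) (k≤leftSize q lk below) (pop-greatest q v₂ l₂ below-right))
  where
  len : length v₁ ≡ length (code p)
  len = Pointwise-length l₁
  below-left : ∀ {z} → z ⋖ p → v₁ ⊑ code z
  below-left {z} r =
    proj₁ (⊑-++⁻ v₁ (code z) (trans len (sym (Pointwise-length (⋖⇒⊑ r)))) (below (left r)))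
  below-right : ∀ {z} → z ⋖ q → v₂ ⊑ code z
  below-right r = proj₂ (proj₂ (⊑-++⁻ v₁ (code p) len (below (right r))))
  k≤leftSize : ∀ q → k ≤ size q → (∀ {z} → z ⋖ node p q → v₁ ++ k ∷ v₂ ⊑ code z) → k ≤ leftSize q
  k≤leftSize leaf       lk below = lk
  k≤leftSize (node a b) lk below =
    proj₁ (proj₂ (⊑-++⁻ v₁ (code p) len (subst (v₁ ++ k ∷ v₂ ⊑_) (code-rotated p a b) (below rotate))))

PopRel-pop : ∀ t → PopRel (size t) (word t) (word (pop t))
PopRel-pop t = subst (λ n → Dyck n (word (pop t))) (size-pop t) (Dyck-word (pop t)) , lower , greatest
  where
  lower : ∀ s → CoveredBy (size t) s (word t) ⊎ s ≡ word t → word (pop t) ≤T s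
  lower s (inj₁ cov) with z , z⋖t , refl ← CoveredBy⇒⋖ {t = t} refl cov = ⊑⇒≤T (pop t) z (pop-⊑-⋖ z⋖t)
  lower s (inj₂ refl) = ⊑⇒≤T (pop t) t (pop-⊑ t)
  greatest : ∀ l → Dyck (size t) l → (∀ s → CoveredBy (size t) s (word t) ⊎ s ≡ word t → l ≤T s) →
             l ≤T word (pop t)
  greatest l dl below with u , _ , refl ← Dyck⇒tree dl =
    ⊑⇒≤T u (pop t) (pop-greatest t (code u) (≤T-word⇒⊑ u t (below _ (inj₂ refl)))
      λ {z} r → ≤T-word⇒⊑ u z (below _ (inj₁ (⋖⇒CoveredBy r))))

IsMeet-unique : ∀ {n S m m′} → IsMeet n S m → IsMeet n S m′ → m ≡ m′
IsMeet-unique (dm , lower , greatest) (dm′ , lower′ , greatest′)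
  with u , _ , refl ← Dyck⇒tree dm | u′ , _ , refl ← Dyck⇒tree dm′ =
  cong word (⊑-code-antisym u u′ (≤T-word⇒⊑ u u′ (greatest′ _ dm lower))
                                 (≤T-word⇒⊑ u′ u (greatest _ dm′ lower′)))

-- Iterates of Pop and sortability

popIter : ℕ → Tree → Tree
popIter zero    u = u
popIter (suc t) u = popIter t (pop u)

PopIter-popIter : ∀ t u → PopIter (size u) t (word u) (word (popIter t u))
PopIter-popIter zero    u = done
PopIter-popIter (suc t) u =
  step (PopRel-pop u) (subst (λ n → PopIter n t (word (pop u)) (word (popIter t (pop u)))) (size-pop u)
    (PopIter-popIter t (pop u)))

PopIter⇒popIter : ∀ t u {y} → PopIter (size u) t (word u) y → y ≡ word (popIter t u)
PopIter⇒popIter zero    u done = refl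
PopIter⇒popIter (suc t) u {y} (step r rest) with refl ← IsMeet-unique r (PopRel-pop u) =
  PopIter⇒popIter t (pop u) (subst (λ n → PopIter n t (word (pop u)) y) (sym (size-pop u)) rest)

-- In the plane forest, the last child of every node with children is childless. Pop then takes
-- exactly one N out of each nonempty interior.
data Thin : Tree → Set where
  leaf   : Thin leaf
  node₀  : ∀ {p} → Thin p → Thin (node p leaf)
  node₁  : ∀ {p a} → Thin p → Thin a → Thin (node p (node a leaf))

-- Each last child that is handed over hands over its own last child in turn; the chain ends with a
-- childless one.
popOnto-shape : ∀ F q → ∃[ c ] popOnto F q ≡ node c leaf
popOnto-shape F leaf       = F , refl
popOnto-shape F (node a b) = popOnto-shape (node F (pop a)) b

Thin-nodePop : ∀ {F} a → Thin F → Thin (pop a) → Thin (node F (pop a))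
Thin-nodePop leaf       tF ta = node₀ tF
Thin-nodePop (node p q) tF ta with popOnto (pop p) q | popOnto-shape (pop p) q
Thin-nodePop (node p q) tF (node₀ ta) | _ | c , refl = node₁ tF ta

-- Every interior in the result is itself of the form `pop a`, hence empty or ending with a
-- childless component by `popOnto-shape`.
Thin-pop     : ∀ t → Thin (pop t)
Thin-popOnto : ∀ {F} → Thin F → ∀ q → Thin (popOnto F q)
Thin-pop leaf              = leaf
Thin-pop (node p q)        = Thin-popOnto (Thin-pop p) q
Thin-popOnto tF leaf       = node₀ tF
Thin-popOnto tF (node a b) = Thin-popOnto (Thin-nodePop a tF (Thin-pop a)) b

code-pop-Thin : ∀ {u} → Thin u → code (pop u) ≡ map pred (code u)
code-pop-Thin leaf = refl
code-pop-Thin (node₀ {p} tp) = begin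
  code (pop (node p leaf))              ≡⟨ code-pop p leaf ⟩
  code (pop p) ++ 0 ∷ []                ≡⟨ cong (_++ 0 ∷ []) (code-pop-Thin tp) ⟩
  map pred (code p) ++ 0 ∷ []           ≡⟨ map-++ pred (code p) _ ⟨
  map pred (code p ++ 0 ∷ [])           ∎
  where open ≡-Reasoning
code-pop-Thin (node₁ {p} {a} tp ta) = begin
  code (pop (node p (node a leaf)))
    ≡⟨ code-pop p (node a leaf) ⟩
  code (pop p) ++ size a ∷ code (pop (node a leaf))
    ≡⟨ cong₂ (λ v w → v ++ size a ∷ w) (code-pop-Thin tp) (code-pop-Thin (node₀ ta)) ⟩
  map pred (code p) ++ size a ∷ map pred (code (node a leaf))
    ≡⟨ cong (λ k → map pred (code p) ++ k ∷ map pred (code (node a leaf))) (cong pred (+-comm 1 (size a))) ⟩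
  map pred (code p) ++ map pred (size (node a leaf) ∷ code (node a leaf))
    ≡⟨ map-++ pred (code p) _ ⟨
  map pred (code (node p (node a leaf)))
    ∎
  where open ≡-Reasoning

code-popIter-Thin : ∀ t {u} → Thin u → code (popIter t u) ≡ map (_∸ t) (code u)
code-popIter-Thin zero    {u} tu = sym (map-id (code u))
code-popIter-Thin (suc t) {u} tu = begin
  code (popIter t (pop u))          ≡⟨ code-popIter-Thin t (Thin-pop u) ⟩
  map (_∸ t) (code (pop u))         ≡⟨ cong (map (_∸ t)) (code-pop-Thin tu) ⟩
  map (_∸ t) (map pred (code u))    ≡⟨ map-∘ (code u) ⟨
  map (λ k → pred k ∸ t) (code u)   ≡⟨ map-cong (λ k → ∸-suc-pred k) (code u) ⟩
  map (_∸ suc t) (code u)           ∎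
  where
  open ≡-Reasoning
  ∸-suc-pred : ∀ k → pred k ∸ t ≡ k ∸ suc t
  ∸-suc-pred zero    = 0∸n≡0 t
  ∸-suc-pred (suc k) = refl

size-popIter : ∀ t u → size (popIter t u) ≡ size u
size-popIter zero    u = refl
size-popIter (suc t) u = trans (size-popIter t (pop u)) (size-pop u)

zeroHat-snoc : ∀ n → zeroHat n ++ N ∷ E ∷ [] ≡ zeroHat (suc n)
zeroHat-snoc zero    = refl
zeroHat-snoc (suc n) = cong (λ w → N ∷ E ∷ w) (zeroHat-snoc n)

codes-zeroHat : ∀ n → All (_≡ 0) (codes (zeroHat n))
codes-zeroHat zero    = []
codes-zeroHat (suc n) = refl ∷ codes-zeroHat n

word≡zeroHat⇒zeros : ∀ u n → word u ≡ zeroHat n → All (_≡ 0) (code u)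
word≡zeroHat⇒zeros u n eq = subst (All (_≡ 0)) (trans (cong codes (sym eq)) (codes-word u)) (codes-zeroHat n)

zeros⇒word≡zeroHat : ∀ u → All (_≡ 0) (code u) → word u ≡ zeroHat (size u)
zeros⇒word≡zeroHat leaf       _  = refl
zeros⇒word≡zeroHat (node p leaf) zs = begin
  word p ++ N ∷ E ∷ []              ≡⟨ cong (_++ N ∷ E ∷ []) (zeros⇒word≡zeroHat p (All.++⁻ˡ (code p) zs)) ⟩
  zeroHat (size p) ++ N ∷ E ∷ []    ≡⟨ zeroHat-snoc (size p) ⟩
  zeroHat (suc (size p))            ≡⟨ cong zeroHat (+-comm 1 (size p)) ⟩
  zeroHat (size p + 1)              ∎
  where open ≡-Reasoning
zeros⇒word≡zeroHat (node p (node a b)) zs with eq ∷ _ ← All.++⁻ʳ (code p) zs =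
  contradiction (trans (sym (+-suc (size a) (size b))) eq) λ ()

-- For `q = node a b` the bound concerns the factor N a N b E E; for an empty `q` it says only that
-- `t` is positive.
data OK (t : ℕ) : Tree → Set where
  leaf : OK t leaf
  node : ∀ {p q} → OK t p → leftSize q < t → OK t q → OK t (node p q)

OK⇒pop< : ∀ {t u} → OK t u → All (_< t) (code (pop u))
OK⇒pop< leaf = []
OK⇒pop< (node {p} {q} okp l okq) =
  subst (All _) (sym (code-pop p q)) (All.++⁺ (OK⇒pop< okp) (l ∷ OK⇒pop< okq))

pop<⇒OK : ∀ {t} u → All (_< t) (code (pop u)) → OK t u
pop<⇒OK leaf       _  = leaf
pop<⇒OK (node p q) ls with ls′ ← subst (All _) (code-pop p q) ls
  with l ∷ lq ← All.++⁻ʳ (code (pop p)) ls′ = node (pop<⇒OK p (All.++⁻ˡ (code (pop p)) ls′)) l (pop<⇒OK q lq)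

-- The first of the `suc t` applications of Pop yields a thin tree and the other `t` subtract `t`
-- from each entry, so reaching the minimum means that no entry exceeds `t` after the first one.
Sortable⇒OK : ∀ {t n} u → size u ≡ n → Sortable n (suc t) (word u) → OK (suc t) u
Sortable⇒OK {t} u refl (_ , it) = pop<⇒OK u (All.map (s≤s ∘ m∸n≡0⇒m≤n) (All.map⁻ zeros))
  where
  zeros : All (_≡ 0) (map (_∸ t) (code (pop u)))
  zeros = subst (All (_≡ 0)) (code-popIter-Thin t (Thin-pop u))
    (word≡zeroHat⇒zeros (popIter t (pop u)) (size u) (sym (PopIter⇒popIter (suc t) u it)))

OK⇒Sortable : ∀ {t n} u → size u ≡ n → OK (suc t) u → Sortable n (suc t) (word u)
OK⇒Sortable {t} u refl ok =
  Dyck-word u , subst (PopIter (size u) (suc t) (word u)) sorted (PopIter-popIter (suc t) u)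
  where
  open ≡-Reasoning
  zeros : All (_≡ 0) (code (popIter t (pop u)))
  zeros = subst (All (_≡ 0)) (sym (code-popIter-Thin t (Thin-pop u)))
    (All.map⁺ (All.map (m≤n⇒m∸n≡0 ∘ s≤s⁻¹) (OK⇒pop< ok)))
  sorted : word (popIter (suc t) u) ≡ zeroHat (size u)
  sorted = trans (zeros⇒word≡zeroHat (popIter t (pop u)) zeros) (cong zeroHat (size-popIter (suc t) u))

-- Counting sortable trees

private variable
  A B I : Set

Count : (A → Set) → ℕ → Set
Count {A} P k = Σ (List A) λ L → Unique L × (∀ x → x ∈ L → P x) × (∀ x → P x → x ∈ L) × length L ≡ k

Count-unique : ∀ {P : A → Set} {k l} → Count P k → Count P l → k ≡ l
Count-unique (L , uL , sL , cL , refl) (M , uM , sM , cM , refl) =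
  ↭-length (∼bag⇒↭ (unique∧set⇒bag uL uM (mk⇔ (λ {x∈L → cM _ (sL _ x∈L)}) (λ {x∈M → cL _ (sM _ x∈M)}))))

Unique-map : (f : A → B) (g : B → A) → ∀ {xs} → All (λ x → g (f x) ≡ x) xs → Unique xs → Unique (map f xs)
Unique-map f g []         []         = []
Unique-map f g (eq ∷ eqs) (x∉ ∷ uxs) =
  All.map⁺ (All.zipWith (λ (eq′ , x≢y) fx≡fy → x≢y (trans (sym eq) (trans (cong g fx≡fy) eq′))) (eqs , x∉))
  ∷ Unique-map f g eqs uxs

Count-bijection : ∀ {P : A → Set} {Q : B → Set} {k} (f : A → B) (g : B → A) →
  (∀ {x} → P x → Q (f x)) → (∀ {y} → Q y → P (g y)) →
  (∀ {x} → P x → g (f x) ≡ x) → (∀ {y} → Q y → f (g y) ≡ y) → Count P k → Count Q k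
Count-bijection {Q = Q} f g P⇒Q Q⇒P gf fg (L , uL , sL , cL , len) =
  map f L , Unique-map f g (All.tabulate (gf ∘ sL _)) uL , sound ,
  (λ y qy → subst (_∈ map f L) (fg qy) (∈-map⁺ f (cL _ (Q⇒P qy)))) , trans (length-map f L) len
  where
  sound : ∀ y → y ∈ map f L → Q y
  sound y y∈ with x , x∈L , refl ← ∈-map⁻ f y∈ = P⇒Q (sL x x∈L)

Count-⇔ : ∀ {P Q : A → Set} {k} → (∀ x → P x → Q x) → (∀ x → Q x → P x) → Count P k → Count Q k
Count-⇔ P⇒Q Q⇒P (L , uL , sL , cL , len) =
  L , uL , (λ x x∈ → P⇒Q x (sL x x∈)) , (λ x qx → cL x (Q⇒P x qx)) , len

Count-image : ∀ {P : A → Set} {k} (f : A → B) → (∀ {x y} → f x ≡ f y → x ≡ y) → Count P k →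
  Count (λ z → ∃[ x ] (P x × z ≡ f x)) k
Count-image f inj (L , uL , sL , cL , len) =
  map f L , Unique.map⁺ inj uL ,
  (λ z z∈ → let x , x∈ , eq = ∈-map⁻ f z∈ in x , sL x x∈ , eq) ,
  (λ { _ (x , px , refl) → ∈-map⁺ f (cL x px) }) ,
  trans (length-map f L) len

Count-∪ : ∀ {P Q : A → Set} {k l} → (∀ x → P x → ¬ Q x) → Count P k → Count Q l →
  Count (λ x → P x ⊎ Q x) (k + l)
Count-∪ disj (L , uL , sL , cL , refl) (M , uM , sM , cM , refl) =
  L ++ M ,
  Unique.++⁺ uL uM (λ (x∈L , x∈M) → disj _ (sL _ x∈L) (sM _ x∈M)) ,
  (λ x x∈ → Sum.map (sL x) (sM x) (∈-++⁻ L x∈)) ,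
  (λ x → [ ∈-++⁺ˡ ∘ cL x , ∈-++⁺ʳ L ∘ cM x ]) ,
  length-++ L

Count-⊎ : ∀ {P : A → Set} {Q : B → Set} {k l} → Count P k → Count Q l → Count [ P , Q ] (k + l)
Count-⊎ {P = P} {Q} cP cQ = Count-⇔
  (λ { _ (inj₁ (x , px , refl)) → px ; _ (inj₂ (y , qy , refl)) → qy })
  (λ { (inj₁ x) px → inj₁ (x , px , refl) ; (inj₂ y) qy → inj₂ (y , qy , refl) })
  (Count-∪ (λ { _ (_ , _ , refl) (_ , _ , ()) })
    (Count-image inj₁ inj₁-injective cP) (Count-image inj₂ inj₂-injective cQ))

Count-∅ : ∀ {P : A → Set} → (∀ x → ¬ P x) → Count P 0
Count-∅ ¬P = [] , [] , (λ _ ()) , (λ x px → contradiction px (¬P x)) , refl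

Count-singleton : ∀ {P : A → Set} x → P x → (∀ y → P y → y ≡ x) → Count P 1
Count-singleton x px uniq =
  x ∷ [] , [] ∷ [] , (λ { y (here refl) → px }) , (λ y py → here (uniq y py)) , refl

Count-Σ : ∀ {P : I → A → Set} {c : I → ℕ} → (∀ i → Count (P i) (c i)) → ∀ is → Unique is →
  Count (λ (i , x) → i ∈ is × P i x) (sum (map c is))
Count-Σ count []       []          = Count-∅ λ _ ()
Count-Σ {I = I} {A = A} {P = P} count (i ∷ is) (i∉is ∷ uis) = Count-⇔ to from
  (Count-∪ (λ { _ (_ , _ , refl) (i∈is , _) → All.lookup i∉is i∈is refl })
    (Count-image (i ,_) (λ { refl → refl }) (count i)) (Count-Σ count is uis))
  where
  P∈ : List I → I × A → Set
  P∈ js (j , x) = j ∈ js × P j x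
  to : ∀ z → ∃[ x ] (P i x × z ≡ (i , x)) ⊎ P∈ is z → P∈ (i ∷ is) z
  to _ (inj₁ (x , px , refl)) = here refl , px
  to _ (inj₂ (i∈ , px))       = there i∈ , px
  from : ∀ z → P∈ (i ∷ is) z → ∃[ x ] (P i x × z ≡ (i , x)) ⊎ P∈ is z
  from (_ , x) (here refl , px) = inj₁ (x , px , refl)
  from _       (there i∈ , px)  = inj₂ (i∈ , px)

sum-const : ∀ (l : ℕ) (xs : List A) → sum (map (λ _ → l) xs) ≡ length xs * l
sum-const l []       = refl
sum-const l (x ∷ xs) = cong (l +_) (sum-const l xs)

Count-× : ∀ {P : A → Set} {Q : B → Set} {k l} → Count P k → Count Q l →
  Count (λ (x , y) → P x × Q y) (k * l)
Count-× {Q = Q} {l = l} (L , uL , sL , cL , refl) cQ = subst (Count _) (sum-const l L)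
  (Count-⇔ (λ (x , _) (x∈ , qy) → sL x x∈ , qy) (λ (x , _) (px , qy) → cL x px , qy)
    (Count-Σ (λ _ → cQ) L uL))

-- Ballot numbers and Catalan numbers

ballot : ℕ → ℕ → ℕ
ballot zero    k       = 1
ballot (suc n) zero    = 0
ballot (suc n) (suc k) = ballot (suc n) k + ballot n (suc (suc k))

totalSize : ∀ {k} → Vec Tree k → ℕ
totalSize = Vec.sum ∘ Vec.map size

totalSize-node : ∀ {k} l r (ts : Vec Tree k) → totalSize (node l r ∷ ts) ≡ suc (totalSize (l ∷ r ∷ ts))
totalSize-node l r ts = trans (+-assoc (size l) _ _) (+-suc (size l) _)

empty-forest : ∀ {k} (ts : Vec Tree k) → totalSize ts ≡ 0 → ts ≡ Vec.replicate k leaf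
empty-forest []                eq = refl
empty-forest (leaf ∷ ts)       eq = cong (leaf ∷_) (empty-forest ts eq)
empty-forest (node l r ∷ ts)   eq with () ← trans (sym (totalSize-node l r ts)) eq

totalSize-replicate-leaf : ∀ k → totalSize (Vec.replicate k leaf) ≡ 0
totalSize-replicate-leaf zero    = refl
totalSize-replicate-leaf (suc k) = totalSize-replicate-leaf k

-- The first tree of a nonempty forest is either a leaf or is split at its root.
Count-forests : ∀ n k → Count (λ (ts : Vec Tree k) → totalSize ts ≡ n) (ballot n k)
Count-forests zero    k       = Count-singleton (Vec.replicate k leaf) (totalSize-replicate-leaf k) empty-forest
Count-forests (suc n) zero    = Count-∅ λ { [] () }
Count-forests (suc n) (suc k) = Count-bijection join split
  (λ {z} → join-size z) (λ {ts} → split-size ts) (λ {z} _ → split∘join z) (λ {ts} _ → join∘split ts)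
  (Count-⊎ (Count-forests (suc n) k) (Count-forests n (suc (suc k))))
  where
  join : Vec Tree k ⊎ Vec Tree (suc (suc k)) → Vec Tree (suc k)
  join (inj₁ ts)           = leaf ∷ ts
  join (inj₂ (l ∷ r ∷ ts)) = node l r ∷ ts
  split : Vec Tree (suc k) → Vec Tree k ⊎ Vec Tree (suc (suc k))
  split (leaf ∷ ts)     = inj₁ ts
  split (node l r ∷ ts) = inj₂ (l ∷ r ∷ ts)
  join-size : ∀ z → [ (λ ts → totalSize ts ≡ suc n) , (λ ts → totalSize ts ≡ n) ] z → totalSize (join z) ≡ suc n
  join-size (inj₁ ts)           eq = eq
  join-size (inj₂ (l ∷ r ∷ ts)) eq = trans (totalSize-node l r ts) (cong suc eq)
  split-size : ∀ ts → totalSize ts ≡ suc n → [ (λ ts → totalSize ts ≡ suc n) , (λ ts → totalSize ts ≡ n) ] (split ts)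
  split-size (leaf ∷ ts)     eq = eq
  split-size (node l r ∷ ts) eq = suc-injective (trans (sym (totalSize-node l r ts)) eq)
  split∘join : ∀ z → split (join z) ≡ z
  split∘join (inj₁ ts)           = refl
  split∘join (inj₂ (l ∷ r ∷ ts)) = refl
  join∘split : ∀ ts → join (split ts) ≡ ts
  join∘split (leaf ∷ ts)     = refl
  join∘split (node l r ∷ ts) = refl

-- n C (j - 1), read as 0 when j = 0.
_C⁻_ : ℕ → ℕ → ℕ
n C⁻ zero  = 0
n C⁻ suc j = n C j

pascal : ∀ n j → suc n C suc j ≡ n C j + n C suc j
pascal n j = sym (nCk+nC[k+1]≡[n+1]C[k+1] n j)

pascal⁻ : ∀ n j → suc n C j ≡ n C⁻ j + n C j
pascal⁻ n zero    = refl
pascal⁻ n (suc j) = pascal n j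

central-symmetry : ∀ m → suc (m + m) C m ≡ suc (m + m) C suc m
central-symmetry m = trans (nCk≡nC[n∸k] (m≤n⇒m≤1+n (m≤m+n m m)))
  (cong (suc (m + m) C_) (trans (cong (_∸ m) (sym (+-suc m m))) (m+n∸m≡n m (suc m))))

pascal-sum : ∀ b₁ b₂ M m → b₁ + M C m ≡ M C suc m → b₂ + M C⁻ m ≡ M C m →
  b₁ + b₂ + suc M C m ≡ suc M C suc m
pascal-sum b₁ b₂ M m eq₁ eq₂ = begin
  b₁ + b₂ + suc M C m           ≡⟨ cong (b₁ + b₂ +_) (pascal⁻ M m) ⟩
  b₁ + b₂ + (M C⁻ m + M C m)    ≡⟨ regroup b₁ b₂ (M C⁻ m) (M C m) ⟩
  (b₁ + M C m) + (b₂ + M C⁻ m)  ≡⟨ cong₂ _+_ eq₁ eq₂ ⟩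
  M C suc m + M C m             ≡⟨ +-comm (M C suc m) (M C m) ⟩
  M C m + M C suc m             ≡⟨ pascal M m ⟨
  suc M C suc m                 ∎
  where
  open ≡-Reasoning
  regroup : ∀ a b c d → a + b + (c + d) ≡ (a + d) + (b + c)
  regroup = solve-∀

-- The reflection formula: a ballot number is a difference of neighbouring binomials in row 2n + k,
-- stated without subtraction. Pascal's rule adds up the identities for the two summands of the
-- ballot recurrence.
ballot-C : ∀ n k → ballot n (suc k) + (n + n + k) C⁻ n ≡ (n + n + k) C n
ballot-C zero    k       = refl
-- Here the first summand `ballot (suc m) 0` is 0, and its identity is the symmetry of row 2m + 1.
ballot-C (suc m) zero    =
  subst (λ M → ballot (suc m) 1 + M C m ≡ M C suc m) (double-suc m)
    (pascal-sum 0 (ballot m 2) (suc (m + m)) m (central-symmetry m)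
      (subst (λ M → ballot m 2 + M C⁻ m ≡ M C m) (+-comm (m + m) 1) (ballot-C m 1)))
  where
  double-suc : ∀ m → suc (suc (m + m)) ≡ suc m + suc m + 0
  double-suc = solve-∀
ballot-C (suc m) (suc k) =
  subst (λ M → ballot (suc m) (suc (suc k)) + M C m ≡ M C suc m) (sym (+-suc (suc m + suc m) k))
    (pascal-sum (ballot (suc m) (suc k)) (ballot m (suc (suc (suc k)))) (suc m + suc m + k) m
      (ballot-C (suc m) k)
      (subst (λ M → ballot m (suc (suc (suc k))) + M C⁻ m ≡ M C m) (shift m k) (ballot-C m (suc (suc k)))))
  where
  shift : ∀ m k → m + m + suc (suc k) ≡ suc m + suc m + k
  shift = solve-∀

-- The rule (k + 1) C(n, k + 1) = (n - k) C(n, k), arranged so that no truncated subtraction occurs.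
absorption : ∀ n k → suc k * (n C suc k) + k * (n C k) ≡ n * (n C k)
absorption zero    zero    = refl
absorption zero    (suc k) = cong₂ _+_ (*-zeroʳ (suc (suc k))) (*-zeroʳ (suc k))
absorption (suc n) zero    = begin
  1 * (suc n C 1) + 0  ≡⟨ +-identityʳ _ ⟩
  1 * (suc n C 1)      ≡⟨ *-identityˡ _ ⟩
  suc n C 1          ≡⟨ nC1≡n (suc n) ⟩
  suc n              ≡⟨ *-identityʳ (suc n) ⟨
  suc n * 1          ∎
  where open ≡-Reasoning
absorption (suc n) (suc k) = begin
  suc (suc k) * (suc n C suc (suc k)) + suc k * (suc n C suc k)
    ≡⟨ cong₂ (λ x y → suc (suc k) * x + suc k * y) (pascal n (suc k)) (pascal n k) ⟩
  suc (suc k) * (c₁ + c₂) + suc k * (c₀ + c₁)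
    ≡⟨ regroup k c₀ c₁ c₂ ⟩
  (suc (suc k) * c₂ + suc k * c₁) + (suc k * c₁ + k * c₀) + (c₀ + c₁)
    ≡⟨ cong₂ (λ x y → x + y + (c₀ + c₁)) (absorption n (suc k)) (absorption n k) ⟩
  n * c₁ + n * c₀ + (c₀ + c₁)
    ≡⟨ collect n c₀ c₁ ⟩
  suc n * (c₀ + c₁)
    ≡⟨ cong (suc n *_) (pascal n k) ⟨
  suc n * (suc n C suc k) ∎
  where
  open ≡-Reasoning
  c₀ = n C k
  c₁ = n C suc k
  c₂ = n C suc (suc k)
  regroup : ∀ k c₀ c₁ c₂ → suc (suc k) * (c₁ + c₂) + suc k * (c₀ + c₁) ≡
    (suc (suc k) * c₂ + suc k * c₁) + (suc k * c₁ + k * c₀) + (c₀ + c₁)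
  regroup = solve-∀
  collect : ∀ n c₀ c₁ → n * c₁ + n * c₀ + (c₀ + c₁) ≡ suc n * (c₀ + c₁)
  collect = solve-∀

-- Makes the division in `catalan` exact. Reflection gives `b + x ≡ y` and absorption gives
-- `m * y ≡ suc m * x`; multiplying the first by `suc m` and cancelling leaves the claim.
central-binomial≡ballot : ∀ m → (m + m) C m ≡ ballot m 1 * suc m
central-binomial≡ballot zero      = refl
central-binomial≡ballot m@(suc j) = +-cancelʳ-≡ (suc m * x) _ _ (begin
  y + suc m * x           ≡⟨ cong (y +_) m*y ⟨
  y + m * y               ≡⟨ cong (suc m *_) b+x ⟨
  suc m * (b + x)         ≡⟨ distrib (suc m) b x ⟩
  b * suc m + suc m * x   ∎)
  where
  open ≡-Reasoning
  x = (m + m) C j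
  y = (m + m) C m
  b = ballot m 1
  b+x : b + x ≡ y
  b+x = subst (λ n → b + n C j ≡ n C m) (+-identityʳ (m + m)) (ballot-C m 0)
  split-2m : ∀ j x → (suc j + suc j) * x ≡ suc (suc j) * x + j * x
  split-2m = solve-∀
  m*y : m * y ≡ suc m * x
  m*y = +-cancelʳ-≡ (j * x) _ _ (trans (absorption (m + m) j) (split-2m j x))
  distrib : ∀ k u v → k * (u + v) ≡ u * k + k * v
  distrib = solve-∀

catalan≡ballot : ∀ m → catalan m ≡ ballot m 1
catalan≡ballot m = trans (cong (_/ suc m) (central-binomial≡ballot m)) (m*n/n≡m (ballot m 1) (suc m))

Count-trees : ∀ m → Count (λ t → size t ≡ m) (catalan m)
Count-trees m = subst (Count _) (sym (catalan≡ballot m)) (Count-bijection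
  Vec.head (_∷ [])
  (λ { {t ∷ []} eq → trans (sym (+-identityʳ (size t))) eq }) (trans (+-identityʳ _))
  (λ { {t ∷ []} _ → refl }) (λ _ → refl)
  (Count-forests m 1))

-- The recurrence for the number of sortable trees

ifZero : ℕ → ℕ
ifZero zero    = 1
ifZero (suc _) = 0

-- The number of admissible inserted trees with `m` nodes. For m ≥ 1 it is minus the coefficient of
-- z^(m+1) in the denominator; for m = 0 and positive `t` it is 1 and accounts for one of the two
-- copies of z there.
catalanBelow : ℕ → ℕ → ℕ
catalanBelow t m with suc m ≤? t
... | yes _ = catalan m
... | no  _ = 0

Count-trees-below : ∀ t m → Count (λ a → size a ≡ m × m < t) (catalanBelow t m)
Count-trees-below t m with suc m ≤? t
... | yes m<t = Count-⇔ (λ _ eq → eq , m<t) (λ _ → proj₁) (Count-trees m)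
... | no  m≮t = Count-∅ λ _ (_ , m<t) → m≮t m<t

-- Leaves the inserted tree arbitrary: with so few nodes, no `leftSize` inside it can reach `t`.
size≤⇒OK : ∀ {t} u → size u ≤ t → OK t u
size≤⇒OK leaf       le = leaf
size≤⇒OK (node p q) le = node
  (size≤⇒OK p (≤-trans (m≤m+n (size p) _) le))
  (≤-trans (s≤s (leftSize≤size q)) q<t)
  (size≤⇒OK q (<⇒≤ q<t))
  where q<t = ≤-trans (m≤n+m (suc (size q)) (size p)) le

NonemptyOK : ℕ → ℕ → Tree → Set
NonemptyOK t n u = 1 ≤ n × size u ≡ n × OK t u

OKTree : ℕ → ℕ → Tree → Set
OKTree t n u = size u ≡ n × OK t u

module _ (t : ℕ) (H : ℕ → ℕ) (count : ∀ n → Count (NonemptyOK t n) (H n)) (0<t : 0 < t) where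

  Count-OK : ∀ n → Count (OKTree t n) (H n + ifZero n)
  Count-OK zero = Count-⇔
    (λ { _ (inj₂ refl) → refl , leaf })
    (λ { leaf _ → inj₂ refl ; (node p q) (eq , _) → contradiction (trans (sym (+-suc (size p) _)) eq) λ () })
    (Count-∪ (λ { _ (() , _) }) (count 0) (Count-singleton leaf refl λ _ eq → eq))
  Count-OK (suc n) = subst (Count _) (sym (+-identityʳ (H (suc n))))
    (Count-⇔ (λ _ → proj₂) (λ _ ok → s≤s z≤n , ok) (count (suc n)))

  -- The bound `k` gives access to partial sums: k = n + 1 occurs in the recurrence, and k = n omits
  -- the term with an empty inserted tree.
  convolved : ℕ → ℕ → ℕ
  convolved n k = sum (map (λ i → H i * catalanBelow t (n ∸ i)) (upTo k))

  Hanging : ℕ → ℕ × Tree × Tree → Set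
  Hanging n (i , u , a) = i ∈ upTo (suc n) × NonemptyOK t i u × size a ≡ n ∸ i × n ∸ i < t

  -- A tree with at least one node is either node p leaf, or node p (node a b), which is encoded
  -- by node p b together with a: its right subtrees carry the same conditions, apart from size a < t.
  Count-OK-suc : ∀ n → Count (NonemptyOK t (suc n)) (H n + ifZero n + convolved n (suc n))
  Count-OK-suc n = Count-bijection join split
    (λ {z} → join-OK z) (λ {u} → split-OK u) (λ {z} → split∘join z) (λ {u} → join∘split u)
    (Count-⊎ (Count-OK n)
      (Count-Σ (λ i → Count-× (count i) (Count-trees-below t (n ∸ i))) (upTo (suc n)) (Unique.upTo⁺ (suc n))))
    where
    Piece : Tree ⊎ (ℕ × Tree × Tree) → Set
    Piece = [ OKTree t n , Hanging n ]
    join : Tree ⊎ (ℕ × Tree × Tree) → Tree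
    join (inj₁ p)                  = node p leaf
    -- A default value: `u` is nonempty in every triple that is counted.
    join (inj₂ (i , leaf , a))     = leaf
    join (inj₂ (i , node p b , a)) = node p (node a b)
    split : Tree → Tree ⊎ (ℕ × Tree × Tree)
    split leaf                = inj₁ leaf
    split (node p leaf)       = inj₁ p
    split (node p (node a b)) = inj₂ (size (node p b) , node p b , a)
    size-hang : ∀ p a b → size (node p (node a b)) ≡ suc (size (node p b) + size a)
    size-hang p a b = arith (size p) (size a) (size b)
      where
      arith : ∀ x y z → x + suc (y + suc z) ≡ suc (x + suc z + y)
      arith = solve-∀
    join-OK : ∀ z → Piece z → NonemptyOK t (suc n) (join z)
    join-OK (inj₁ p) (refl , ok) = s≤s z≤n , +-comm (size p) 1 , node ok 0<t leaf
    join-OK (inj₂ (_ , leaf , a)) (_ , (() , refl , _) , _)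
    join-OK (inj₂ (_ , node p b , a)) (i∈ , (_ , refl , node okp l okb) , eq , a<t) =
      s≤s z≤n ,
      trans (size-hang p a b) (cong suc (trans (cong (size (node p b) +_) eq) (m+[n∸m]≡n (s≤s⁻¹ (∈-upTo⁻ i∈))))) ,
      node okp a<t′ (node (size≤⇒OK a (<⇒≤ a<t′)) l okb)
      where a<t′ = subst (_< t) (sym eq) a<t
    split-OK : ∀ u → NonemptyOK t (suc n) u → Piece (split u)
    split-OK leaf (_ , () , _)
    split-OK (node p leaf) (_ , eq , node ok _ _) = suc-injective (trans (+-comm 1 (size p)) eq) , ok
    split-OK (node p (node a b)) (_ , eq , node okp a<t (node _ l okb)) =
      ∈-upTo⁺ (s≤s (m+n≤o⇒m≤o (size (node p b)) (≤-reflexive total))) ,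
      (≤-trans (s≤s z≤n) (m≤n+m (suc (size b)) (size p)) , refl , node okp l okb) ,
      sym rest , subst (_< t) (sym rest) a<t
      where
      total : size (node p b) + size a ≡ n
      total = suc-injective (trans (sym (size-hang p a b)) eq)
      rest : n ∸ size (node p b) ≡ size a
      rest = trans (cong (_∸ size (node p b)) (sym total)) (m+n∸m≡n (size (node p b)) (size a))
    split∘join : ∀ z → Piece z → split (join z) ≡ z
    split∘join (inj₁ p) _ = refl
    split∘join (inj₂ (_ , leaf , a)) (_ , (() , refl , _) , _)
    split∘join (inj₂ (_ , node p b , a)) (_ , (_ , refl , _) , _) = refl
    join∘split : ∀ u → NonemptyOK t (suc n) u → join (split u) ≡ u
    join∘split leaf (_ , () , _)
    join∘split (node p leaf) _       = refl
    join∘split (node p (node a b)) _ = refl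

  recurrence : ∀ n → H (suc n) ≡ H n + ifZero n + convolved n (suc n)
  recurrence n = Count-unique (count (suc n)) (Count-OK-suc n)

nonempty : (ℕ → ℕ) → ℕ → ℕ
nonempty h zero    = 0
nonempty h (suc n) = h (suc n)

HasCount⇒Count-OK : ∀ t h → (∀ n → 1 ≤ n → HasCount (Sortable n (suc t)) (h n)) →
  ∀ n → Count (NonemptyOK (suc t) n) (nonempty h n)
HasCount⇒Count-OK t h count zero    = Count-∅ λ { _ (() , _) }
HasCount⇒Count-OK t h count (suc n) = Count-bijection parse word
  parse-OK (λ {u} (_ , eq , ok) → OK⇒Sortable u eq ok)
  (λ (dyck , _) → word-parse-Dyck dyck) (λ {u} _ → parse-word u) (count (suc n) (s≤s z≤n))
  where
  word-parse-Dyck : ∀ {w} → Dyck (suc n) w → word (parse w) ≡ w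
  word-parse-Dyck dyck with u , _ , refl ← Dyck⇒tree dyck = cong word (parse-word u)
  parse-OK : ∀ {w} → Sortable (suc n) (suc t) w → NonemptyOK (suc t) (suc n) (parse w)
  parse-OK s@(dyck , _) with u , eq , refl ← Dyck⇒tree dyck rewrite parse-word u =
    s≤s z≤n , eq , Sortable⇒OK u eq s

-- Coefficients of the generating function

map-upTo-suc : ∀ (f : ℕ → A) n → map f (upTo (suc n)) ≡ map f (upTo n) ++ f n ∷ []
map-upTo-suc f n = trans (cong (map f) (sym (upTo-∷ʳ n))) (map-++ f (upTo n) (n ∷ []))

sum-upTo-suc : ∀ f n → sum (map f (upTo (suc n))) ≡ sum (map f (upTo n)) + f n
sum-upTo-suc f n = begin
  sum (map f (upTo (suc n)))             ≡⟨ cong sum (map-upTo-suc f n) ⟩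
  sum (map f (upTo n) ++ f n ∷ [])       ≡⟨ sum-++ (map f (upTo n)) _ ⟩
  sum (map f (upTo n)) + (f n + 0)       ≡⟨ cong (sum (map f (upTo n)) +_) (+-identityʳ (f n)) ⟩
  sum (map f (upTo n)) + f n             ∎
  where open ≡-Reasoning

sumℤ-snoc : ∀ xs x → sumℤ (xs ++ x ∷ []) ≡ sumℤ xs +ᶻ x
sumℤ-snoc []       x = ℤ.+-comm x (⁺ 0)
sumℤ-snoc (y ∷ ys) x = trans (cong (y +ᶻ_) (sumℤ-snoc ys x)) (sym (ℤ.+-assoc y (sumℤ ys) x))

sumℤ-upTo-suc : ∀ f n → sumℤ (map f (upTo (suc n))) ≡ sumℤ (map f (upTo n)) +ᶻ f n
sumℤ-upTo-suc f n = trans (cong sumℤ (map-upTo-suc f n)) (sumℤ-snoc (map f (upTo n)) (f n))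

denom-suc-suc : ∀ t m → denom t (suc (suc m)) ≡ - (⁺ catalanBelow t (suc m))
denom-suc-suc t m with suc (suc m) ≤? t
... | yes _ = refl
... | no  _ = refl

toSeries-nonempty : ∀ h n → toSeries h n ≡ ⁺ nonempty h n
toSeries-nonempty h zero    = refl
toSeries-nonempty h (suc n) = refl

theorem1p1 : (t : ℕ) → 1 ≤ t → (h : ℕ → ℕ) →
    (∀ n → 1 ≤ n → HasCount (Sortable n t) (h n)) →
    ∀ k → (toSeries h ⊛ denom t) k ≡ zSeries k
theorem1p1 (suc s) 1≤t h count zero    = refl
theorem1p1 (suc s) 1≤t h count (suc n) = begin
  sumℤ (map term (upTo (suc (suc n))))
    -- The last two terms are split off, as they meet the coefficients -2 and 1 of the denominator;
    -- the earlier ones meet the coefficients of degree at least 2.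
    ≡⟨ sumℤ-upTo-suc term (suc n) ⟩
  sumℤ (map term (upTo (suc n))) +ᶻ term (suc n)
    ≡⟨ cong (_+ᶻ term (suc n)) (sumℤ-upTo-suc term n) ⟩
  sumℤ (map term (upTo n)) +ᶻ term n +ᶻ term (suc n)
    ≡⟨ cong₂ (λ x y → x +ᶻ y +ᶻ term (suc n)) (partial n ≤-refl) term-n ⟩
  - (⁺ S) +ᶻ ⁺ H n *ᶻ (- (⁺ 2)) +ᶻ term (suc n)
    ≡⟨ cong (- (⁺ S) +ᶻ ⁺ H n *ᶻ (- (⁺ 2)) +ᶻ_) term-suc-n ⟩
  - (⁺ S) +ᶻ ⁺ H n *ᶻ (- (⁺ 2)) +ᶻ ⁺ H (suc n)
    -- The recurrence contributes `H n` twice, once from the trees X N E and once from the insertion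
    -- of an empty A, which cancels the coefficient -2.
    ≡⟨ cong (λ x → - (⁺ S) +ᶻ ⁺ H n *ᶻ (- (⁺ 2)) +ᶻ ⁺ x) H-suc ⟩
  - (⁺ S) +ᶻ ⁺ H n *ᶻ (- (⁺ 2)) +ᶻ (⁺ H n +ᶻ ⁺ ifZero n +ᶻ (⁺ S +ᶻ ⁺ H n))
    ≡⟨ cancel (⁺ S) (⁺ H n) (⁺ ifZero n) ⟩
  ⁺ ifZero n
    ≡⟨ ifZero≡zSeries n ⟩
  zSeries (suc n) ∎
  where
  open ≡-Reasoning
  t = suc s
  H = nonempty h
  countH = HasCount⇒Count-OK s h count
  term : ℕ → ℤ
  term i = toSeries h i *ᶻ denom t (suc n ∸ i)
  conv : ℕ → ℕ
  conv = convolved t H countH 1≤t n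
  S = conv n
  partial : ∀ k → k ≤ n → sumℤ (map term (upTo k)) ≡ - (⁺ conv k)
  partial zero    _   = refl
  partial (suc k) k<n = begin
    sumℤ (map term (upTo (suc k)))                  ≡⟨ sumℤ-upTo-suc term k ⟩
    sumℤ (map term (upTo k)) +ᶻ term k             ≡⟨ cong₂ _+ᶻ_ (partial k (<⇒≤ k<n)) term-k ⟩
    - (⁺ conv k) +ᶻ - (⁺ c)                ≡⟨ ℤ.neg-distrib-+ (⁺ conv k) (⁺ c) ⟨
    - (⁺ (conv k + c))
      ≡⟨ cong (λ x → - (⁺ x)) (sum-upTo-suc (λ i → H i * catalanBelow t (n ∸ i)) k) ⟨
    - (⁺ conv (suc k))                          ∎
    where
    c = H k * catalanBelow t (n ∸ k)
    denom-k : denom t (suc n ∸ k) ≡ - (⁺ catalanBelow t (n ∸ k))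
    -- Writing `n` as k + 1 + m turns `suc n ∸ k` into m + 2 and `n ∸ k` into m + 1, so that the
    -- third clause of `denom` applies.
    denom-k with m , eq ← m≤n⇒∃[o]m+o≡n k<n =
      subst (λ n → denom t (suc n ∸ k) ≡ - (⁺ catalanBelow t (n ∸ k))) eq
        (subst₂ (λ x y → denom t x ≡ - (⁺ catalanBelow t y))
          (sym (trans
            (cong (_∸ k) (trans (cong suc (sym (+-suc k m))) (sym (+-suc k (suc m))))) (m+n∸m≡n k (suc (suc m)))))
          (sym (trans (cong (_∸ k) (sym (+-suc k m))) (m+n∸m≡n k (suc m))))
          (denom-suc-suc t m))
    term-k : term k ≡ - (⁺ c)
    term-k = begin
      toSeries h k *ᶻ denom t (suc n ∸ k)                   ≡⟨ cong₂ _*ᶻ_ (toSeries-nonempty h k) denom-k ⟩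
      ⁺ H k *ᶻ (- (⁺ catalanBelow t (n ∸ k)))         ≡⟨ ℤ.neg-distribʳ-* (⁺ H k) _ ⟨
      - (⁺ H k *ᶻ ⁺ catalanBelow t (n ∸ k))           ≡⟨ cong -_ (ℤ.pos-* (H k) _) ⟨
      - (⁺ c)                                            ∎
  term-n : term n ≡ ⁺ H n *ᶻ (- (⁺ 2))
  term-n = cong₂ _*ᶻ_ (toSeries-nonempty h n) (cong (denom t) (m+n∸n≡m 1 n))
  term-suc-n : term (suc n) ≡ ⁺ H (suc n)
  term-suc-n = trans (cong (λ d → ⁺ H (suc n) *ᶻ denom t d) (n∸n≡0 n)) (ℤ.*-identityʳ _)
  H-suc : H (suc n) ≡ H n + ifZero n + (S + H n)
  H-suc = begin
    H (suc n)                              ≡⟨ recurrence t H countH 1≤t n ⟩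
    H n + ifZero n + conv (suc n)
      ≡⟨ cong (H n + ifZero n +_) (sum-upTo-suc (λ i → H i * catalanBelow t (n ∸ i)) n) ⟩
    H n + ifZero n + (S + H n * catalanBelow t (n ∸ n))
      ≡⟨ cong (λ d → H n + ifZero n + (S + H n * catalanBelow t d)) (n∸n≡0 n) ⟩
    H n + ifZero n + (S + H n * 1)         ≡⟨ cong (λ x → H n + ifZero n + (S + x)) (*-identityʳ (H n)) ⟩
    H n + ifZero n + (S + H n)             ∎
  cancel : ∀ a b c → - a +ᶻ b *ᶻ (- (⁺ 2)) +ᶻ (b +ᶻ c +ᶻ (a +ᶻ b)) ≡ c
  cancel = ℤ-solve-∀
  ifZero≡zSeries : ∀ n → ⁺ ifZero n ≡ zSeries (suc n)
  ifZero≡zSeries zero    = refl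
  ifZero≡zSeries (suc n) = refl
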